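{- For every integer $n\geq 2$, $$L_n = A_n = n!\,Q_n,$$ where $L_n$ is the number of preference lists $\alpha\in[n]^n$ with exactly $n-1$ lucky cars, $Q_n=2(n+1)H_n-4n$ (with $H_n=\sum_{i=1}^n \frac1i$) is the expected number of pivot comparisons made by Quicksort on a uniformly random ordering of an array of size $n$, and $A_n$ is the total number of pivot comparisons made by Quicksort over all $n!$ orderings of an array of size $n$; that is, $L_n=n!\,[2(n+1)H_n-4n]$.
   Context: Parking: For $n\in\mathbb{N}$ let $[n]=\{1,\dots,n\}$. A preference list of length $n$ is a tuple $\alpha=(p_1,\dots,p_n)\in[n]^n$. Cars $1,2,\dots,n$ enter, in this order, a one-way street with parking spots $1,\dots,n$. Car $i$ parks in the first unoccupied spot numbered greater than or equal to $p_i$, if such a spot exists; otherwise car $i$ is unable to park (and the remaining cars continue in order). Car $i$ is lucky if it parks in its preferred spot $p_i$; a car that is unable to park is not lucky. $\mathrm{Lucky}(\alpha)$ is the number of lucky cars of $\alpha$. It is not required that all cars be able to park. Set $L_n=|\{\alpha\in[n]^n:\mathrm{Lucky}(\alpha)=n-1\}|$. Quicksort: Given an array of $n\ge 1$ elements, Quicksort selects a pivot element, makes $n-1$ pivot comparisons to split the other elements into a left array (elements less than or equal to the pivot) and a right array (elements greater than the pivot), and then recurses separately on the left and right arrays. The expected number $Q_n$ of pivot comparisons (including all recursive calls) on an array of size $n$ ordered uniformly at random is determined by $Q_0=0$ and, for $n\geq 1$, $Q_n=(n-1)+\frac1n\sum_{k=1}^n (Q_{k-1}+Q_{n-k})$ (the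 pivot being equally likely to be the $k$th smallest element for each $k$); it is given in closed form by $Q_n=2(n+1)H_n-4n$, where $H_n=\sum_{i=1}^n\frac1i$. The total number of comparisons over all $n!$ orderings is $A_n=n!\,Q_n$. -}

module Defs where

open import Data.Nat.Base using (ℕ; zero; suc; _+_; _∸_; _≤_; _<_; s≤s; _!)
import Data.Nat.Properties as ℕ
open import Data.Nat.ListAction using (sum)
open import Data.Nat.Induction using (Acc; acc; <-wellFounded)
open import Data.Integer.Base using (+_)
open import Data.Rational.Base as ℚ using (ℚ; 0ℚ; _/_)
open import Data.Bool.Base using (if_then_else_)
open import Data.Fin.Base using (Fin; punchIn)
import Data.Fin.Base as Fin
import Data.Fin.Properties as Fin
open import Data.Fin.Subset using (Subset; ⊥; ⁅_⁆; _∪_)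
open import Data.Fin.Subset.Properties using (_∈?_)
open import Data.List.Base as List
  using (List; []; _∷_; allFin; cartesianProductWith; filter; find; length; lookup; removeAt)
open import Data.List.Properties using (length-filter; length-removeAt)
open import Data.Maybe.Base using (Maybe; just; nothing)
open import Data.Vec.Base as Vec using (Vec; []; _∷_)
open import Relation.Binary.PropositionalEquality using (subst)
open import Relation.Nullary.Decidable using (does; ¬?; _×-dec_)
open import Level using (0ℓ)
open import Relation.Unary using (Pred; Decidable)

-- Spots, preferences and array entries in {1,…,n} are represented by Fin n,
-- i.e. shifted down by one.

PreferenceList : ℕ → Set
PreferenceList n = Vec (Fin n) n

parkingSpot : ∀ {n} → Subset n → Fin n → Maybe (Fin n)
parkingSpot {n} occupied p =
  find (λ s → (p Fin.≤? s) ×-dec ¬? (s ∈? occupied)) (allFin n)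

-- The number of lucky cars among cars with the given preferences that enter,
-- in order, a street on which the spots in `occupied` are already taken.
luckyFrom : ∀ {n k} → Subset n → Vec (Fin n) k → ℕ
luckyFrom occupied []       = 0
luckyFrom occupied (p ∷ ps) with parkingSpot occupied p
... | nothing = luckyFrom occupied ps
... | just s  = (if does (s Fin.≟ p) then 1 else 0) + luckyFrom (occupied ∪ ⁅ s ⁆) ps

Lucky : ∀ {n} → PreferenceList n → ℕ
Lucky α = luckyFrom ⊥ α

-- All words of length k over [n], each listed exactly once.
words : ∀ n k → List (Vec (Fin n) k)
words n zero    = [] ∷ []
words n (suc k) = cartesianProductWith _∷_ (allFin n) (words n k)

preferenceLists : ∀ n → List (PreferenceList n)
preferenceLists n = words n n

L : ℕ → ℕ
L n = length (filter (λ α → Lucky α ℕ.≟ n ∸ 1) (preferenceLists n))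

-- The position of the pivot in an array of size suc k.  The position may depend
-- on the size of the array but not on its contents, so that in a uniformly
-- random ordering every element is equally likely to be the pivot.
PivotRule : Set
PivotRule = ∀ k → Fin (suc k)

module _ (pivotAt : PivotRule) {m : ℕ} where

  part< : ∀ {P : Pred (Fin m) 0ℓ} (P? : Decidable P) x (xs : List (Fin m)) i →
          length (filter P? (removeAt (x ∷ xs) i)) < length (x ∷ xs)
  part< P? x xs i =
    s≤s (subst (length (filter P? rest) ≤_) (length-removeAt (x ∷ xs) i) (length-filter P? rest))
    where rest = removeAt (x ∷ xs) i

  -- The accessibility argument only serves termination.
  comparisonsAcc : (xs : List (Fin m)) → Acc _<_ (length xs) → ℕ
  comparisonsAcc []       _         = 0
  comparisonsAcc (x ∷ xs) (acc rec) =
    length rest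
      + comparisonsAcc (filter left?  rest) (rec (part< left?  x xs i))
      + comparisonsAcc (filter right? rest) (rec (part< right? x xs i))
    where
    i      = pivotAt (length xs)
    pivot  = lookup (x ∷ xs) i
    rest   = removeAt (x ∷ xs) i
    left?  = λ y → y Fin.≤? pivot
    right? = λ y → pivot Fin.<? y

  comparisons : List (Fin m) → ℕ
  comparisons xs = comparisonsAcc xs (<-wellFounded (length xs))

-- All n! orderings of [n], each listed exactly once: choose the first entry i,
-- then order the remaining elements, which punchIn i enumerates increasingly.
orderings : ∀ n → List (Vec (Fin n) n)
orderings zero    = [] ∷ []
orderings (suc n) =
  cartesianProductWith (λ i w → i ∷ Vec.map (punchIn i) w) (allFin (suc n)) (orderings n)

A : PivotRule → ℕ → ℕ
A pivotAt n = sum (List.map (λ w → comparisons pivotAt (Vec.toList w)) (orderings n))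

-- The mean of the number of comparisons over the n! orderings.
Q : PivotRule → ℕ → ℚ
Q pivotAt n = (+ A pivotAt n / n !) {{n ℕ.!≢0}}

H : ℕ → ℚ
H zero    = 0ℚ
H (suc n) = H n ℚ.+ + 1 / suc n

fromℕ : ℕ → ℚ
fromℕ n = + n / 1

{-# OPTIONS --safe #-}
-- Both numbers X satisfy X + 4 n n! = 2 (n + 1) n! Hₙ.
--
-- Quicksort: for every pivot rule, removing the pivot from a uniformly random
-- ordering and filtering the rest leaves uniformly random orderings of the two
-- parts, and the rank of the pivot is uniform.  This gives the recurrence
-- aₙ = (n - 1) n! + 2 Σ_{k<n} (n-1)!/k! aₖ.
--
-- Parking: k lucky cars occupy k distinct free spots, so if d + k spots are
-- free they do so in (d + k)!/d! ways.  When the unlucky car arrives and k + 1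
-- spots are free, k cars are still to come; they continue in k! ways if the car
-- parks and in (k + 1)! = k! + k k! ways if it fails.  The car fails exactly if
-- all spots from its preference p on are taken, so the surplus k k! is
-- accounted for separately for each p, where it depends only on the numbers of
-- free spots before p and from p on.
module Submission where

open import Defs
open import Data.Nat.Base
  using (ℕ; zero; suc; _≥_; _!; _+_; _∸_; _≤_; _<_; s≤s; z≤n; NonZero) renaming (_*_ to _·_)
import Data.Nat.Properties as ℕ
open import Data.Nat.Induction using (acc; <-rec)
open import Data.Nat.ListAction using (sum)
open import Data.Nat.ListAction.Properties using (sum-++)
open import Data.Nat.Tactic.RingSolver using (solve-∀)
import Data.Integer.Base as ℤ
import Data.Integer.Properties as ℤ
open import Data.Rational.Base using (_*_; _-_; 0ℚ; _/_)
import Data.Rational.Base as ℚ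
import Data.Rational.Properties as ℚ
open import Data.Rational.Unnormalised.Base as ℚᵘ using (mkℚᵘ; _≃_; *≡*)
import Data.Rational.Unnormalised.Properties as ℚᵘ
open import Data.Bool.Base using (if_then_else_; true; false)
open import Data.Fin.Base using (Fin; zero; suc; punchIn; cast)
import Data.Fin.Base as Fin
import Data.Fin.Properties as Fin
open import Data.Fin.Subset using (Subset; ⊥; ⁅_⁆; _∪_; _∈_; _∉_)
open import Data.Fin.Subset.Properties using (_∈?_; ∉⊥; x∈⁅x⁆; x∈⁅y⁆⇒x≡y; x∈p∪q⁺; x∈p∪q⁻)
open import Data.List.Base
  using (List; []; _∷_; _++_; map; length; filter; find; lookup; removeAt; tabulate; allFin; cartesianProductWith)
open import Data.List.Properties
  using (map-cong-local; map-++; map-tabulate; length-map; length-tabulate; length-filter; length-removeAt;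
         filter-accept; filter-reject; filter-all; filter-none; filter-≐)
open import Data.List.Relation.Unary.All as All using (All; []; _∷_)
import Data.List.Relation.Unary.All.Properties as All
open import Data.List.Relation.Unary.AllPairs using (AllPairs; []; _∷_)
import Data.List.Relation.Unary.AllPairs.Properties as AllPairs
open import Data.Maybe.Base using (just; nothing; maybe′)
open import Data.Product.Base using (_×_; _,_; proj₁; proj₂; map₂)
open import Data.Sum.Base using (inj₁; inj₂)
open import Data.Vec.Base as Vec using (Vec; []; _∷_)
import Data.Vec.Properties as Vec
open import Algebra.Properties.CommutativeSemigroup ℕ.+-commutativeSemigroup
  using (interchange) renaming (x∙yz≈y∙xz to exchange)
open import Function.Base using (_∘_; flip; id)
open import Level using (0ℓ)
open import Relation.Binary.PropositionalEquality
  using (_≡_; _≢_; refl; sym; trans; cong; cong₂; subst; module ≡-Reasoning)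
open import Relation.Nullary using (¬_; contradiction)
open import Relation.Nullary.Decidable using (Dec; yes; no; does; ¬?; _×-dec_; dec-true; dec-false; dec⇒maybe)
open import Relation.Unary using (Pred; Decidable)
open import Tactic.RingSolver using () renaming (solve-∀ to ring-∀)
open import Tactic.RingSolver.Core.AlmostCommutativeRing using (AlmostCommutativeRing; fromCommutativeRing)

private variable
  I J K : Set

-- Finite sums

∑ : List I → (I → ℕ) → ℕ
∑ xs f = sum (map f xs)

∑-cong-All : ∀ {f g : I → ℕ} {xs} → All (λ x → f x ≡ g x) xs → ∑ xs f ≡ ∑ xs g
∑-cong-All eqs = cong sum (map-cong-local eqs)

∑-cong : ∀ (xs : List I) {f g : I → ℕ} → (∀ x → f x ≡ g x) → ∑ xs f ≡ ∑ xs g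
∑-cong xs eq = ∑-cong-All (All.universal eq xs)

∑-+ : ∀ (xs : List I) (f g : I → ℕ) → ∑ xs (λ x → f x + g x) ≡ ∑ xs f + ∑ xs g
∑-+ []       f g = refl
∑-+ (x ∷ xs) f g rewrite ∑-+ xs f g = interchange (f x) (g x) (∑ xs f) (∑ xs g)

∑-*ˡ : ∀ (xs : List I) c (f : I → ℕ) → ∑ xs (λ x → c · f x) ≡ c · ∑ xs f
∑-*ˡ []       c f = sym (ℕ.*-zeroʳ c)
∑-*ˡ (x ∷ xs) c f rewrite ∑-*ˡ xs c f = sym (ℕ.*-distribˡ-+ c (f x) (∑ xs f))

∑-*ʳ : ∀ (xs : List I) c (f : I → ℕ) → ∑ xs (λ x → f x · c) ≡ ∑ xs f · c
∑-*ʳ xs c f = trans (∑-cong xs λ x → ℕ.*-comm (f x) c) (trans (∑-*ˡ xs c f) (ℕ.*-comm c _))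

∑-const : ∀ (xs : List I) c → ∑ xs (λ _ → c) ≡ length xs · c
∑-const []       c = refl
∑-const (x ∷ xs) c = cong (c +_) (∑-const xs c)

∑-swap : ∀ (xs : List I) (ys : List J) (f : I → J → ℕ) →
         ∑ xs (λ x → ∑ ys (f x)) ≡ ∑ ys (λ y → ∑ xs (λ x → f x y))
∑-swap []       ys f = sym (trans (∑-const ys 0) (ℕ.*-zeroʳ (length ys)))
∑-swap (x ∷ xs) ys f = trans (cong (∑ ys (f x) +_) (∑-swap xs ys f)) (sym (∑-+ ys (f x) _))

∑-map : ∀ (h : I → J) xs (f : J → ℕ) → ∑ (map h xs) f ≡ ∑ xs (f ∘ h)
∑-map h []       f = refl
∑-map h (x ∷ xs) f = cong (f (h x) +_) (∑-map h xs f)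

∑-++ : ∀ (xs ys : List I) (f : I → ℕ) → ∑ (xs ++ ys) f ≡ ∑ xs f + ∑ ys f
∑-++ xs ys f = trans (cong sum (map-++ f xs ys)) (sum-++ (map f xs) (map f ys))

∑-cartesianProductWith : ∀ (h : I → J → K) xs ys (f : K → ℕ) →
  ∑ (cartesianProductWith h xs ys) f ≡ ∑ xs (λ x → ∑ ys (λ y → f (h x y)))
∑-cartesianProductWith h []       ys f = refl
∑-cartesianProductWith h (x ∷ xs) ys f =
  trans (∑-++ (map (h x) ys) _ f)
        (cong₂ _+_ (∑-map (h x) ys f) (∑-cartesianProductWith h xs ys f))

𝟙 : ∀ {P : Set} → Dec P → ℕ
𝟙 d = if does d then 1 else 0

length-filter-∑ : ∀ {P : Pred I 0ℓ} (P? : Decidable P) xs → length (filter P? xs) ≡ ∑ xs (𝟙 ∘ P?)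
length-filter-∑ P? []       = refl
length-filter-∑ P? (x ∷ xs) with does (P? x)
... | true  = cong suc (length-filter-∑ P? xs)
... | false = length-filter-∑ P? xs

-- The sum of f l r over all l + r + 1 = n.
antidiagonal : (ℕ → ℕ → ℕ) → ℕ → ℕ
antidiagonal f zero    = 0
antidiagonal f (suc n) = f 0 n + antidiagonal (f ∘ suc) n

antidiagonal-cong : ∀ n {f g} → (∀ l r → suc (l + r) ≡ n → f l r ≡ g l r) →
                    antidiagonal f n ≡ antidiagonal g n
antidiagonal-cong zero    eq = refl
antidiagonal-cong (suc n) eq =
  cong₂ _+_ (eq 0 n refl) (antidiagonal-cong n λ l r e → eq (suc l) r (cong suc e))

antidiagonal-+ : ∀ n f g → antidiagonal (λ l r → f l r + g l r) n ≡ antidiagonal f n + antidiagonal g n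
antidiagonal-+ zero    f g = refl
antidiagonal-+ (suc n) f g rewrite antidiagonal-+ n (f ∘ suc) (g ∘ suc) =
  interchange (f 0 n) (g 0 n) (antidiagonal (f ∘ suc) n) (antidiagonal (g ∘ suc) n)

antidiagonal-*ˡ : ∀ n c f → antidiagonal (λ l r → c · f l r) n ≡ c · antidiagonal f n
antidiagonal-*ˡ zero    c f = sym (ℕ.*-zeroʳ c)
antidiagonal-*ˡ (suc n) c f rewrite antidiagonal-*ˡ n c (f ∘ suc) = sym (ℕ.*-distribˡ-+ c (f 0 n) _)

antidiagonal-last : ∀ n f → antidiagonal f (suc n) ≡ f n 0 + antidiagonal (λ l → f l ∘ suc) n
antidiagonal-last zero    f = refl
antidiagonal-last (suc n) f rewrite antidiagonal-last n (f ∘ suc) =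
  exchange (f 0 (suc n)) (f (suc n) 0) _

-- The definition peels off the term with `l` zero, `antidiagonal-last` the one with `r` zero;
-- flipping exchanges the two.
antidiagonal-flip : ∀ n f → antidiagonal (flip f) n ≡ antidiagonal f n
antidiagonal-flip zero    f = refl
antidiagonal-flip (suc n) f =
  trans (cong (f n 0 +_) (antidiagonal-flip n (λ l → f l ∘ suc))) (sym (antidiagonal-last n f))

-- Recurrences

-- n! Hₙ
harmonic! : ℕ → ℕ
harmonic! zero    = 0
harmonic! (suc n) = suc n · harmonic! n + n !

-- (p + q)! / p!
rising : ℕ → ℕ → ℕ
rising p zero    = 1
rising p (suc q) = (p + suc q) · rising p q

rising-! : ∀ p q → rising p q · p ! ≡ (p + q) !
rising-! p zero    = trans (ℕ.+-identityʳ (p !)) (cong _! (sym (ℕ.+-identityʳ p)))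
rising-! p (suc q) = begin
  (p + suc q) · rising p q · p !    ≡⟨ ℕ.*-assoc (p + suc q) (rising p q) (p !) ⟩
  (p + suc q) · (rising p q · p !)  ≡⟨ cong ((p + suc q) ·_) (rising-! p q) ⟩
  (p + suc q) · (p + q) !           ≡⟨ cong (_· (p + q) !) (ℕ.+-suc p q) ⟩
  suc (p + q) !                     ≡⟨ cong _! (ℕ.+-suc p q) ⟨
  (p + suc q) !                     ∎
  where open ≡-Reasoning

-- The sum of n!/k! aₖ over k ≤ n, where aₖ is quicksortTotal k.
quicksortSum : ℕ → ℕ
quicksortSum zero    = 0
quicksortSum (suc n) = (n + 3) · quicksortSum n + n · suc n !

quicksortTotal : ℕ → ℕ
quicksortTotal zero    = 0
quicksortTotal (suc n) = n · suc n ! + 2 · quicksortSum n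

-- Each passage from n to n + 1 multiplies the old terms by n + 1 and adds the new last term
-- a_{n+1}. Substituting a_{n+1} = n (n+1)! + 2 `quicksortSum n` turns the factor n + 1 into the n +
-- 3 of `quicksortSum`.
antidiagonal-quicksortTotal : ∀ n →
  antidiagonal (λ l r → rising l r · quicksortTotal l) (suc n) ≡ quicksortSum n
antidiagonal-quicksortTotal zero    = refl
antidiagonal-quicksortTotal (suc n) = begin
  antidiagonal f (suc (suc n))
    ≡⟨ antidiagonal-last (suc n) f ⟩
  f (suc n) 0 + antidiagonal (λ l → f l ∘ suc) (suc n)
    ≡⟨ cong (f (suc n) 0 +_) (antidiagonal-cong (suc n) scale) ⟩
  f (suc n) 0 + antidiagonal (λ l r → suc n · f l r) (suc n)
    ≡⟨ cong (f (suc n) 0 +_) (antidiagonal-*ˡ (suc n) (suc n) f) ⟩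
  f (suc n) 0 + suc n · antidiagonal f (suc n)
    ≡⟨ cong (λ z → f (suc n) 0 + suc n · z) (antidiagonal-quicksortTotal n) ⟩
  f (suc n) 0 + suc n · quicksortSum n
    ≡⟨ collect n (quicksortSum n) (suc n !) ⟩
  quicksortSum (suc n) ∎
  where
  open ≡-Reasoning
  f : ℕ → ℕ → ℕ
  f l r = rising l r · quicksortTotal l
  scale : ∀ l r → suc (l + r) ≡ suc n → f l (suc r) ≡ suc n · f l r
  scale l r e = trans (cong (λ z → z · rising l r · quicksortTotal l) (trans (ℕ.+-suc l r) e))
                      (ℕ.*-assoc (suc n) (rising l r) (quicksortTotal l))
  collect : ∀ n x y → 1 · (n · y + 2 · x) + suc n · x ≡ (n + 3) · x + n · y
  collect = solve-∀

-- This is the closed form of `quicksortTotal (suc n)` solved for the sum, whence 5 n + 4 = n + 4 (n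
-- + 1). In the induction the remainder 2 (n + 3) (n + 1)! supplies the new harmonic term 1 / (n +
-- 2).
quicksortSum-closed : ∀ n →
  2 · quicksortSum n + (5 · n + 4) · suc n ! ≡ 2 · (n + 2) · harmonic! (suc n)
quicksortSum-closed zero    = refl
quicksortSum-closed (suc n) = begin
  2 · quicksortSum (suc n) + (5 · suc n + 4) · suc (suc n) !
    ≡⟨ before n (quicksortSum n) (suc n !) ⟩
  (n + 3) · (2 · quicksortSum n + (5 · n + 4) · suc n !) + 2 · (n + 3) · suc n !
    ≡⟨ cong (λ z → (n + 3) · z + 2 · (n + 3) · suc n !) (quicksortSum-closed n) ⟩
  (n + 3) · (2 · (n + 2) · harmonic! (suc n)) + 2 · (n + 3) · suc n !
    ≡⟨ after n (harmonic! (suc n)) (suc n !) ⟩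
  2 · (suc n + 2) · harmonic! (suc (suc n)) ∎
  where
  open ≡-Reasoning
  before : ∀ n x f → 2 · ((n + 3) · x + n · f) + (5 · suc n + 4) · (suc (suc n) · f)
                     ≡ (n + 3) · (2 · x + (5 · n + 4) · f) + 2 · (n + 3) · f
  before = solve-∀
  after : ∀ n x f → (n + 3) · (2 · (n + 2) · x) + 2 · (n + 3) · f
                    ≡ 2 · (suc n + 2) · (suc (suc n) · x + f)
  after = solve-∀

quicksortTotal-closed : ∀ n →
  quicksortTotal n + 4 · n · n ! ≡ 2 · suc n · harmonic! n
quicksortTotal-closed zero    = refl
quicksortTotal-closed (suc n) = begin
  n · suc n ! + 2 · quicksortSum n + 4 · suc n · suc n !  ≡⟨ collect n (quicksortSum n) (suc n !) ⟩
  2 · quicksortSum n + (5 · n + 4) · suc n !              ≡⟨ quicksortSum-closed n ⟩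
  2 · (n + 2) · harmonic! (suc n)                         ≡⟨ cong (λ z → 2 · z · harmonic! (suc n)) (ℕ.+-comm n 2) ⟩
  2 · suc (suc n) · harmonic! (suc n)                     ∎
  where
  open ≡-Reasoning
  collect : ∀ n x f → n · f + 2 · x + 4 · suc n · f ≡ 2 · x + (5 · n + 4) · f
  collect = solve-∀

-- The share of a preference p in the number of words with one unlucky car, when
-- r spots from p on and d spots before p are free: whenever lucky cars have
-- filled the former and k + 1 spots are free in all, there is a surplus k k!.
tailWeight : ℕ → ℕ → ℕ
tailWeight zero    zero    = 0
tailWeight zero    (suc d) = d · d ! + suc d · tailWeight 0 d
tailWeight (suc r) zero    = suc r · tailWeight r 0
tailWeight (suc r) (suc d) = suc r · tailWeight r (suc d) + suc d · tailWeight (suc r) d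

-- Merges two clauses of the definition: for `d` zero the truncated `d ∸ 1` is harmless, since its
-- factor `d` vanishes.
tailWeight-suc : ∀ r d → tailWeight (suc r) d ≡ suc r · tailWeight r d + d · tailWeight (suc r) (d ∸ 1)
tailWeight-suc r zero    = sym (ℕ.+-identityʳ _)
tailWeight-suc r (suc d) = refl

-- Divided by d!, the recursion adds d / (d + 1) = 1 - 1 / (d + 1) in each step, which sums to d
-- minus the harmonic number.
tailWeight-zero : ∀ d → tailWeight 0 d + harmonic! d ≡ d · d !
tailWeight-zero zero    = refl
tailWeight-zero (suc d) = begin
  tailWeight 0 (suc d) + harmonic! (suc d)
    ≡⟨ before d (tailWeight 0 d) (harmonic! d) (d !) ⟩
  suc d · (tailWeight 0 d + harmonic! d) + suc d · d !
    ≡⟨ cong (λ z → suc d · z + suc d · d !) (tailWeight-zero d) ⟩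
  suc d · (d · d !) + suc d · d !
    ≡⟨ after d (d !) ⟩
  suc d · suc d ! ∎
  where
  open ≡-Reasoning
  before : ∀ d x y f → (d · f + suc d · x) + (suc d · y + f) ≡ suc d · (x + y) + suc d · f
  before = solve-∀
  after : ∀ d f → suc d · (d · f) + suc d · f ≡ suc d · (suc d · f)
  after = solve-∀

-- On an empty street of n spots, a preference with `d` spots before it has `suc r` spots from it
-- on, itself included. So this is the sum of the shares of all preferences.
tailTotal : ℕ → ℕ
tailTotal = antidiagonal (λ d r → tailWeight (suc r) d)

-- The recursion of `tailWeight` expresses each term through two terms for n. Conversely, the term
-- at (d, r) with d + r + 1 = n is reached with factors r + 2 and d + 1, together n + 2. Only the
-- boundary term `tailWeight 0 n` is left over.
tailTotal-suc : ∀ n → tailTotal (suc n) ≡ (n + 2) · tailTotal n + tailWeight 0 n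
tailTotal-suc n = begin
  tailTotal (suc n)
    ≡⟨ antidiagonal-cong (suc n) (λ d r _ → tailWeight-suc r d) ⟩
  antidiagonal (λ d r → f d r + g d r) (suc n)
    ≡⟨ antidiagonal-+ (suc n) f g ⟩
  antidiagonal f (suc n) + antidiagonal (g ∘ suc) n
    ≡⟨ cong (_+ antidiagonal (g ∘ suc) n) (antidiagonal-last n f) ⟩
  1 · tailWeight 0 n + antidiagonal (λ d → f d ∘ suc) n + antidiagonal (g ∘ suc) n
    ≡⟨ ℕ.+-assoc (1 · tailWeight 0 n) _ _ ⟩
  1 · tailWeight 0 n + (antidiagonal (λ d → f d ∘ suc) n + antidiagonal (g ∘ suc) n)
    ≡⟨ cong (1 · tailWeight 0 n +_) (antidiagonal-+ n (λ d → f d ∘ suc) (g ∘ suc)) ⟨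
  1 · tailWeight 0 n + antidiagonal (λ d r → f d (suc r) + g (suc d) r) n
    ≡⟨ cong (1 · tailWeight 0 n +_) (antidiagonal-cong n merge) ⟩
  1 · tailWeight 0 n + antidiagonal (λ d r → (n + 2) · tailWeight (suc r) d) n
    ≡⟨ cong (1 · tailWeight 0 n +_) (antidiagonal-*ˡ n (n + 2) (λ d r → tailWeight (suc r) d)) ⟩
  1 · tailWeight 0 n + (n + 2) · tailTotal n
    ≡⟨ commute n (tailTotal n) (tailWeight 0 n) ⟩
  (n + 2) · tailTotal n + tailWeight 0 n ∎
  where
  open ≡-Reasoning
  f g : ℕ → ℕ → ℕ
  f d r = suc r · tailWeight r d
  g d r = d · tailWeight (suc r) (d ∸ 1)
  collect : ∀ d r x → suc (suc r) · x + suc d · x ≡ (suc (d + r) + 2) · x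
  collect = solve-∀
  merge : ∀ d r → suc (d + r) ≡ n → f d (suc r) + g (suc d) r ≡ (n + 2) · tailWeight (suc r) d
  merge d r refl = collect d r (tailWeight (suc r) d)
  commute : ∀ n x y → 1 · y + (n + 2) · x ≡ (n + 2) · x + y
  commute = solve-∀

-- Induction along `tailTotal-suc`. The term `harmonic! n` is added on both sides so that
-- `tailWeight-zero` applies without subtraction; it reappears on the right because (n + 2)^2 = (n +
-- 3) (n + 1) + 1.
tailTotal-closed : ∀ n → tailTotal n + 3 · n · n ! ≡ (n + 2) · harmonic! n
tailTotal-closed zero    = refl
tailTotal-closed (suc n) = ℕ.+-cancelʳ-≡ (harmonic! n) _ _ (begin
  tailTotal (suc n) + 3 · suc n · suc n ! + harmonic! n
    ≡⟨ cong (λ z → z + 3 · suc n · suc n ! + harmonic! n) (tailTotal-suc n) ⟩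
  (n + 2) · tailTotal n + tailWeight 0 n + 3 · suc n · suc n ! + harmonic! n
    ≡⟨ regroup n (tailTotal n) (tailWeight 0 n) (n !) (harmonic! n) ⟩
  (n + 2) · tailTotal n + (tailWeight 0 n + harmonic! n) + 3 · suc n · suc n !
    ≡⟨ cong (λ z → (n + 2) · tailTotal n + z + 3 · suc n · suc n !) (tailWeight-zero n) ⟩
  (n + 2) · tailTotal n + n · n ! + 3 · suc n · suc n !
    ≡⟨ before n (tailTotal n) (n !) ⟩
  (n + 2) · (tailTotal n + 3 · n · n !) + (n + 3) · n !
    ≡⟨ cong (λ z → (n + 2) · z + (n + 3) · n !) (tailTotal-closed n) ⟩
  (n + 2) · ((n + 2) · harmonic! n) + (n + 3) · n !
    ≡⟨ after n (harmonic! n) (n !) ⟩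
  (suc n + 2) · harmonic! (suc n) + harmonic! n ∎)
  where
  open ≡-Reasoning
  regroup : ∀ n s w f x → (n + 2) · s + w + 3 · suc n · (suc n · f) + x
                          ≡ (n + 2) · s + (w + x) + 3 · suc n · (suc n · f)
  regroup = solve-∀
  before : ∀ n s f → (n + 2) · s + n · f + 3 · suc n · (suc n · f)
                     ≡ (n + 2) · (s + 3 · n · f) + (n + 3) · f
  before = solve-∀
  after : ∀ n x f → (n + 2) · ((n + 2) · x) + (n + 3) · f ≡ (suc n + 2) · (suc n · x + f) + x
  after = solve-∀

-- The number of words with one unlucky car, when k of m + k spots are free,
-- except that this car counts as if it always parked.
unluckyWeight : ℕ → ℕ → ℕ
unluckyWeight zero    m = 0
unluckyWeight (suc k) m = m · k ! + suc k · unluckyWeight k (suc m)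

-- The recursion keeps the total N of `m` and the first argument fixed. Divided by the factorials,
-- the step from k to k + 1 adds m / (k + 1) = N / (k + 1) - 1.
unluckyWeight-closed : ∀ k m → unluckyWeight k m + k · k ! ≡ (m + k) · harmonic! k
unluckyWeight-closed zero    m = sym (ℕ.*-zeroʳ (m + 0))
unluckyWeight-closed (suc k) m = begin
  unluckyWeight (suc k) m + suc k · suc k !
    ≡⟨ before k m (unluckyWeight k (suc m)) (k !) ⟩
  suc k · (unluckyWeight k (suc m) + k · k !) + (m + suc k) · k !
    ≡⟨ cong (λ z → suc k · z + (m + suc k) · k !) (unluckyWeight-closed k (suc m)) ⟩
  suc k · ((suc m + k) · harmonic! k) + (m + suc k) · k !
    ≡⟨ after k m (harmonic! k) (k !) ⟩
  (m + suc k) · harmonic! (suc k) ∎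
  where
  open ≡-Reasoning
  before : ∀ k m x f → (m · f + suc k · x) + suc k · (suc k · f)
                       ≡ suc k · (x + k · f) + (m + suc k) · f
  before = solve-∀
  after : ∀ k m x f → suc k · ((suc m + k) · x) + (m + suc k) · f
                      ≡ (m + suc k) · (suc k · x + f)
  after = solve-∀

-- Sums over orderings

select : List I → List (I × List I)
select []       = []
select (x ∷ xs) = (x , xs) ∷ map (map₂ (x ∷_)) (select xs)

∑-select-∷ : ∀ (x : I) xs (f : I × List I → ℕ) →
  ∑ (select (x ∷ xs)) f ≡ f (x , xs) + ∑ (select xs) (f ∘ map₂ (x ∷_))
∑-select-∷ x xs f = cong (f (x , xs) +_) (∑-map (map₂ (x ∷_)) (select xs) f)

select-length : ∀ (xs : List I) → All (λ s → suc (length (proj₂ s)) ≡ length xs) (select xs)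
select-length []       = []
select-length (x ∷ xs) = refl ∷ All.map⁺ (All.map (cong suc) (select-length xs))

-- Applied to an indicator, this tracks how many accepted elements remain after one element is
-- removed.
select-∑ : ∀ (f : I → ℕ) xs → All (λ (x , ys) → f x + ∑ ys f ≡ ∑ xs f) (select xs)
select-∑ f []       = []
select-∑ f (x ∷ xs) = refl ∷ All.map⁺ (All.map (λ {(y , ys)} e →
  trans (exchange (f y) (f x) (∑ ys f)) (cong (f x +_) e)) (select-∑ f xs))

length-select : ∀ (xs : List I) → length (select xs) ≡ length xs
length-select []       = refl
length-select (x ∷ xs) = cong suc (trans (length-map _ (select xs)) (length-select xs))

select-All : ∀ {P : Pred I 0ℓ} {xs} → All P xs → All (λ s → P (proj₁ s) × All P (proj₂ s)) (select xs)
select-All []         = []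
select-All (px ∷ pxs) = (px , pxs) ∷ All.map⁺ (All.map (λ (py , pys) → py , px ∷ pys) (select-All pxs))

select-AllPairs : ∀ {R : I → I → Set} {xs} → AllPairs R xs → All (AllPairs R ∘ proj₂) (select xs)
select-AllPairs []         = []
select-AllPairs (px ∷ pxs) =
  pxs ∷ All.map⁺ (All.map (λ ((_ , pys) , qs) → pys ∷ qs) (All.zip (select-All px , select-AllPairs pxs)))

-- The ordered pairs are divided according to whether the head `a` is drawn first, second or not at
-- all. The swap exchanges the first two classes and is the induction hypothesis on the third.
select-swap : ∀ (xs : List I) (f : I → I → List I → ℕ) →
  ∑ (select xs) (λ (x , ys) → ∑ (select ys) (λ (y , zs) → f x y zs)) ≡
  ∑ (select xs) (λ (x , ys) → ∑ (select ys) (λ (y , zs) → f y x zs))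
select-swap []       f = refl
select-swap (a ∷ xs) f = begin
  ∑ (select (a ∷ xs)) (λ (x , ys) → ∑ (select ys) (λ (y , zs) → f x y zs))
    ≡⟨ expand f ⟩
  first f + (second f + third f)
    ≡⟨ cong (λ z → first f + (second f + z)) (select-swap xs (λ x y zs → f x y (a ∷ zs))) ⟩
  first f + (second f + third f′)
    ≡⟨ exchange (first f) (second f) (third f′) ⟩
  first f′ + (second f′ + third f′)
    ≡⟨ expand f′ ⟨
  ∑ (select (a ∷ xs)) (λ (x , ys) → ∑ (select ys) (λ (y , zs) → f y x zs)) ∎
  where
  open ≡-Reasoning
  f′ = λ x y → f y x
  first second third : (_ → _ → List _ → ℕ) → ℕ
  first  g = ∑ (select xs) (λ (y , zs) → g a y zs)
  second g = ∑ (select xs) (λ (x , ys) → g x a ys)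
  third  g = ∑ (select xs) (λ (x , ys) → ∑ (select ys) (λ (y , zs) → g x y (a ∷ zs)))
  expand : ∀ g → ∑ (select (a ∷ xs)) (λ (x , ys) → ∑ (select ys) (λ (y , zs) → g x y zs))
               ≡ first g + (second g + third g)
  expand g = begin
    ∑ (select (a ∷ xs)) (λ (x , ys) → ∑ (select ys) (λ (y , zs) → g x y zs))
      ≡⟨ ∑-select-∷ a xs _ ⟩
    first g + ∑ (select xs) (λ (x , ys) → ∑ (select (a ∷ ys)) (λ (y , zs) → g x y zs))
      ≡⟨ cong (first g +_) (∑-cong (select xs) λ (x , ys) → ∑-select-∷ a ys (λ (y , zs) → g x y zs)) ⟩
    first g + ∑ (select xs) (λ (x , ys) → g x a ys + ∑ (select ys) (λ (y , zs) → g x y (a ∷ zs)))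
      ≡⟨ cong (first g +_) (∑-+ (select xs) (λ (x , ys) → g x a ys) _) ⟩
    first g + (second g + third g) ∎

-- The sum of g over all orderings of n elements of the given list.
permSum : ℕ → List I → (List I → ℕ) → ℕ
permSum zero    xs g = g []
permSum (suc n) xs g = ∑ (select xs) (λ (x , ys) → permSum n ys (g ∘ (x ∷_)))

permSum-cong : ∀ n (xs : List I) {f g} → (∀ w → length w ≡ n → f w ≡ g w) → permSum n xs f ≡ permSum n xs g
permSum-cong zero    xs eq = eq [] refl
permSum-cong (suc n) xs eq =
  ∑-cong (select xs) λ (x , ys) → permSum-cong n ys λ w e → eq (x ∷ w) (cong suc e)

permSum-+ : ∀ n (xs : List I) f g → permSum n xs (λ w → f w + g w) ≡ permSum n xs f + permSum n xs g
permSum-+ zero    xs f g = refl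
permSum-+ (suc n) xs f g =
  trans (∑-cong (select xs) λ (x , ys) → permSum-+ n ys (f ∘ (x ∷_)) (g ∘ (x ∷_)))
        (∑-+ (select xs) (λ (x , ys) → permSum n ys (f ∘ (x ∷_))) _)

permSum-const : ∀ n (xs : List I) c → length xs ≡ n → permSum n xs (λ _ → c) ≡ n ! · c
permSum-const zero    xs c e = sym (ℕ.+-identityʳ c)
permSum-const (suc n) xs c e = begin
  ∑ (select xs) (λ (x , ys) → permSum n ys (λ _ → c))
    ≡⟨ ∑-cong-All (All.map (λ {(_ , ys)} e′ → permSum-const n ys c (ℕ.suc-injective (trans e′ e))) (select-length xs)) ⟩
  ∑ (select xs) (λ _ → n ! · c)
    ≡⟨ ∑-const (select xs) (n ! · c) ⟩
  length (select xs) · (n ! · c)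
    ≡⟨ cong (_· (n ! · c)) (trans (length-select xs) e) ⟩
  suc n · (n ! · c)
    ≡⟨ ℕ.*-assoc (suc n) (n !) c ⟨
  suc n ! · c ∎
  where open ≡-Reasoning

-- The entry at any fixed position may be drawn first: `select-swap` moves its draw to the front
-- past one earlier entry at a time. This is why the total number of comparisons is the same for
-- every pivot rule.
permSum-removeAt : ∀ n (i : Fin (suc n)) (xs : List I) (g : List I → ℕ) (f : I → List I → ℕ) →
  (∀ w (e : suc n ≡ length w) → g w ≡ f (lookup w (cast e i)) (removeAt w (cast e i))) →
  permSum (suc n) xs g ≡ ∑ (select xs) (λ (x , ys) → permSum n ys (f x))
permSum-removeAt n zero xs g f eq =
  ∑-cong (select xs) λ (x , ys) → permSum-cong n ys λ w e → eq (x ∷ w) (cong suc (sym e))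
permSum-removeAt (suc n) (suc i) xs g f eq = begin
  ∑ (select xs) (λ (x , ys) → permSum (suc n) ys (g ∘ (x ∷_)))
    ≡⟨ ∑-cong (select xs) (λ (x , ys) →
         permSum-removeAt n i ys (g ∘ (x ∷_)) (λ y w → f y (x ∷ w)) λ w e → eq (x ∷ w) (cong suc e)) ⟩
  ∑ (select xs) (λ (x , ys) → ∑ (select ys) (λ (y , zs) → permSum n zs (λ w → f y (x ∷ w))))
    ≡⟨ select-swap xs (λ x y zs → permSum n zs (λ w → f y (x ∷ w))) ⟩
  ∑ (select xs) (λ (x , ys) → permSum (suc n) ys (f x)) ∎
  where open ≡-Reasoning

-- Filtering all orderings of a list

module _ {P : Pred I 0ℓ} (P? : Decidable P) where

  private
    accepted rejected : List I → ℕ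
    accepted = length ∘ filter P?
    rejected = length ∘ filter (¬? ∘ P?)

  length-filter-+ : ∀ xs → accepted xs + rejected xs ≡ length xs
  length-filter-+ []       = refl
  length-filter-+ (x ∷ xs) with does (P? x)
  ... | true  = cong suc (length-filter-+ xs)
  ... | false = trans (ℕ.+-suc (accepted xs) (rejected xs)) (cong suc (length-filter-+ xs))

  -- Removing an accepted element and then filtering is the same as selecting from the filtered
  -- list. Removing a rejected element leaves the filtered list unchanged, so each of these
  -- contributes the same value of `g`.
  ∑-select-filter : ∀ (f : I → List I → ℕ) (g : List I → ℕ) xs →
    ∑ (select xs) (λ (x , ys) → if does (P? x) then f x (filter P? ys) else g (filter P? ys)) ≡
    ∑ (select (filter P? xs)) (λ (x , ys) → f x ys) + rejected xs · g (filter P? xs)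
  ∑-select-filter f g []       = refl
  ∑-select-filter f g (a ∷ xs) = trans (∑-select-∷ a xs _) rest
    where
    open ≡-Reasoning
    rest : (if does (P? a) then f a (filter P? xs) else g (filter P? xs))
           + ∑ (select xs) (λ (x , ys) → if does (P? x) then f x (filter P? (a ∷ ys)) else g (filter P? (a ∷ ys)))
           ≡ ∑ (select (filter P? (a ∷ xs))) (λ (x , ys) → f x ys) + rejected (a ∷ xs) · g (filter P? (a ∷ xs))
    rest with does (P? a)
    ... | true = begin
      f a ys + ∑ (select xs) _
        ≡⟨ cong (f a ys +_) (∑-select-filter (λ x → f x ∘ (a ∷_)) (g ∘ (a ∷_)) xs) ⟩
      f a ys + (∑ (select ys) (λ (x , zs) → f x (a ∷ zs)) + rejected xs · g (a ∷ ys))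
        ≡⟨ ℕ.+-assoc (f a ys) _ _ ⟨
      f a ys + ∑ (select ys) (λ (x , zs) → f x (a ∷ zs)) + rejected xs · g (a ∷ ys)
        ≡⟨ cong (_+ rejected xs · g (a ∷ ys)) (∑-select-∷ a ys _) ⟨
      ∑ (select (a ∷ ys)) (λ (x , zs) → f x zs) + rejected xs · g (a ∷ ys) ∎
      where ys = filter P? xs
    ... | false = begin
      g ys + ∑ (select xs) _
        ≡⟨ cong (g ys +_) (∑-select-filter f g xs) ⟩
      g ys + (∑ (select ys) (λ (x , zs) → f x zs) + rejected xs · g ys)
        ≡⟨ exchange (g ys) (∑ (select ys) (λ (x , zs) → f x zs)) (rejected xs · g ys) ⟩
      ∑ (select ys) (λ (x , zs) → f x zs) + (g ys + rejected xs · g ys) ∎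
      where
      ys = filter P? xs

  -- Each ordering of the p accepted elements arises from n! / p! orderings of the whole list; the
  -- equation is multiplied by p! to stay in the naturals. Induction on the first entry: an accepted
  -- one heads the filtered ordering, a rejected one disappears from it.
  permSum-filter-! : ∀ n xs (g : List I → ℕ) → length xs ≡ n →
    permSum n xs (g ∘ filter P?) · accepted xs ! ≡ n ! · permSum (accepted xs) (filter P? xs) g
  permSum-filter-! zero    []  g e = trans (ℕ.*-identityʳ (g [])) (sym (ℕ.+-identityʳ (g [])))
  permSum-filter-! (suc n) xs g e = begin
    ∑ (select xs) (λ (x , ys) → permSum n ys (g ∘ filter P? ∘ (x ∷_))) · p !
      ≡⟨ ∑-*ʳ (select xs) (p !) _ ⟨
    ∑ (select xs) (λ (x , ys) → permSum n ys (g ∘ filter P? ∘ (x ∷_)) · p !)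
      ≡⟨ ∑-cong-All (All.map (λ {s} → term s) (All.zip (select-length xs , select-accepted))) ⟩
    ∑ (select xs) (λ (x , ys) → if does (P? x) then f x (filter P? ys) else f₀ (filter P? ys))
      ≡⟨ ∑-select-filter f f₀ xs ⟩
    ∑ (select zs) (λ (x , ys) → f x ys) + q · f₀ zs
      ≡⟨ cong₂ _+_ (finish p zs refl) (ℕ.*-assoc q (n !) _ ) ⟨
    p · n ! · permSum p zs g + q · n ! · permSum p zs g
      ≡⟨ factor p q (n !) (permSum p zs g) ⟩
    (p + q) · n ! · permSum p zs g
      ≡⟨ cong (λ z → z · n ! · permSum p zs g) (trans (length-filter-+ xs) e) ⟩
    suc n ! · permSum p zs g ∎
    where
    open ≡-Reasoning
    zs = filter P? xs
    p = accepted xs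
    q = rejected xs
    -- The number of entries to order is read off from `ys`: it is p - 1 when an accepted element
    -- has been removed, but p in `f₀`.
    f : I → List I → ℕ
    f x ys = p · (n ! · permSum (length ys) ys (g ∘ (x ∷_)))
    f₀ : List I → ℕ
    f₀ ys = n ! · permSum (length ys) ys g

    select-accepted : All (λ (x , ys) → 𝟙 (P? x) + accepted ys ≡ p) (select xs)
    select-accepted = All.map
      (λ {(x , ys)} a → trans (cong (𝟙 (P? x) +_) (length-filter-∑ P? ys)) (trans a (sym (length-filter-∑ P? xs))))
      (select-∑ (𝟙 ∘ P?) xs)

    term : ∀ s → suc (length (proj₂ s)) ≡ length xs ×
                 𝟙 (P? (proj₁ s)) + accepted (proj₂ s) ≡ p →
           permSum n (proj₂ s) (g ∘ filter P? ∘ (proj₁ s ∷_)) · p ! ≡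
           (if does (P? (proj₁ s)) then f (proj₁ s) (filter P? (proj₂ s)) else f₀ (filter P? (proj₂ s)))
    term (x , ys) (l , a) with does (P? x)
    ... | true = begin
      permSum n ys (g ∘ (x ∷_) ∘ filter P?) · p !
        ≡⟨ cong (λ z → permSum n ys (g ∘ (x ∷_) ∘ filter P?) · z !) a ⟨
      permSum n ys (g ∘ (x ∷_) ∘ filter P?) · (suc (accepted ys) · accepted ys !)
        ≡⟨ rotate (permSum n ys (g ∘ (x ∷_) ∘ filter P?)) (suc (accepted ys)) (accepted ys !) ⟩
      suc (accepted ys) · (permSum n ys (g ∘ (x ∷_) ∘ filter P?) · accepted ys !)
        ≡⟨ cong₂ _·_ a (permSum-filter-! n ys (g ∘ (x ∷_)) (ℕ.suc-injective (trans l e))) ⟩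
      f x (filter P? ys) ∎
      where
      rotate : ∀ a b c → a · (b · c) ≡ b · (a · c)
      rotate = solve-∀
    ... | false = trans (cong (λ z → permSum n ys (g ∘ filter P?) · z !) (sym a))
                        (permSum-filter-! n ys g (ℕ.suc-injective (trans l e)))

    -- Stated for an arbitrary `k` so that `permSum` unfolds after a case split; for `k` zero the
    -- factor `k` makes both sides vanish.
    finish : ∀ k ys → length ys ≡ k →
      k · n ! · permSum k ys g ≡ ∑ (select ys) (λ (x , vs) → k · (n ! · permSum (length vs) vs (g ∘ (x ∷_))))
    finish zero    []  refl = refl
    finish (suc k) ys l = begin
      suc k · n ! · permSum (suc k) ys g
        ≡⟨ ℕ.*-assoc (suc k) (n !) _ ⟩
      suc k · (n ! · permSum (suc k) ys g)
        ≡⟨ cong (suc k ·_) (∑-*ˡ (select ys) (n !) _) ⟨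
      suc k · ∑ (select ys) (λ (x , vs) → n ! · permSum k vs (g ∘ (x ∷_)))
        ≡⟨ ∑-*ˡ (select ys) (suc k) _ ⟨
      ∑ (select ys) (λ (x , vs) → suc k · (n ! · permSum k vs (g ∘ (x ∷_))))
        ≡⟨ ∑-cong-All (All.map (λ {(x , vs)} l′ →
             cong (λ z → suc k · (n ! · permSum z vs (g ∘ (x ∷_)))) (sym (ℕ.suc-injective (trans l′ l))))
             (select-length ys)) ⟩
      ∑ (select ys) (λ (x , vs) → suc k · (n ! · permSum (length vs) vs (g ∘ (x ∷_)))) ∎

    factor : ∀ p q f x → p · f · x + q · f · x ≡ (p + q) · f · x
    factor = solve-∀

  permSum-filter : ∀ n xs (g : List I → ℕ) → length xs ≡ n →
    permSum n xs (g ∘ filter P?) ≡ rising (accepted xs) (rejected xs) · permSum (accepted xs) (filter P? xs) g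
  permSum-filter n xs g e = ℕ.*-cancelʳ-≡ _ _ (accepted xs !) {{ℕ._!≢0 (accepted xs)}} (begin
    permSum n xs (g ∘ filter P?) · p !  ≡⟨ permSum-filter-! n xs g e ⟩
    n ! · X                             ≡⟨ cong (λ z → z ! · X) (trans (length-filter-+ xs) e) ⟨
    (p + q) ! · X                       ≡⟨ cong (_· X) (rising-! p q) ⟨
    rising p q · p ! · X                ≡⟨ rotate (rising p q) (p !) X ⟩
    rising p q · X · p !                ∎)
    where
    open ≡-Reasoning
    p = accepted xs
    q = rejected xs
    X = permSum p (filter P? xs) g
    rotate : ∀ a b c → a · b · c ≡ a · c · b
    rotate = solve-∀

-- Quicksort

antidiagonal-const : ∀ n c → antidiagonal (λ _ _ → c) n ≡ n · c
antidiagonal-const zero    c = refl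
antidiagonal-const (suc n) c = cong (c +_) (antidiagonal-const n c)

-- Connects the two ways of removing an element: `punchIn i` enumerates in order the indices that
-- remain when `i` is selected.
select-tabulate : ∀ {n} (e : Fin (suc n) → I) →
  select (tabulate e) ≡ tabulate (λ i → e i , tabulate (e ∘ punchIn i))
select-tabulate {n = zero}  e = refl
select-tabulate {n = suc n} e = cong ((e zero , tabulate (e ∘ suc)) ∷_)
  (trans (cong (map (map₂ (e zero ∷_))) (select-tabulate (e ∘ suc)))
         (map-tabulate (λ i → e (suc i) , tabulate (e ∘ suc ∘ punchIn i)) (map₂ (e zero ∷_))))

-- The relabelling `e` is there for the induction, since the tail of an ordering is a smaller
-- ordering relabelled by `punchIn i`.
∑-orderings : ∀ n (e : Fin n → I) (g : List I → ℕ) →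
  ∑ (orderings n) (λ w → g (Vec.toList (Vec.map e w))) ≡ permSum n (tabulate e) g
∑-orderings zero    e g = ℕ.+-identityʳ (g [])
∑-orderings (suc n) e g = begin
  ∑ (orderings (suc n)) (λ w → g (Vec.toList (Vec.map e w)))
    ≡⟨ ∑-cartesianProductWith _ (allFin (suc n)) (orderings n) _ ⟩
  ∑ (allFin (suc n)) (λ i → ∑ (orderings n) (λ w → g (e i ∷ Vec.toList (Vec.map e (Vec.map (punchIn i) w)))))
    ≡⟨ ∑-cong (allFin (suc n)) (λ i → ∑-cong (orderings n) λ w →
         cong (λ v → g (e i ∷ Vec.toList v)) (Vec.map-∘ e (punchIn i) w)) ⟨
  ∑ (allFin (suc n)) (λ i → ∑ (orderings n) (λ w → g (e i ∷ Vec.toList (Vec.map (e ∘ punchIn i) w))))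
    ≡⟨ ∑-cong (allFin (suc n)) (λ i → ∑-orderings n (e ∘ punchIn i) (g ∘ (e i ∷_))) ⟩
  ∑ (allFin (suc n)) (λ i → permSum n (tabulate (e ∘ punchIn i)) (g ∘ (e i ∷_)))
    ≡⟨ ∑-map (λ i → e i , tabulate (e ∘ punchIn i)) (allFin (suc n)) (λ (x , ys) → permSum n ys (g ∘ (x ∷_))) ⟨
  ∑ (map (λ i → e i , tabulate (e ∘ punchIn i)) (allFin (suc n))) (λ (x , ys) → permSum n ys (g ∘ (x ∷_)))
    ≡⟨ cong (λ s → ∑ s (λ (x , ys) → permSum n ys (g ∘ (x ∷_))))
         (trans (map-tabulate id (λ i → e i , tabulate (e ∘ punchIn i))) (sym (select-tabulate e))) ⟩
  permSum (suc n) (tabulate e) g ∎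
  where open ≡-Reasoning

module _ {m : ℕ} where

  #≤ #> : Fin m → List (Fin m) → ℕ
  #≤ x ys = length (filter (Fin._≤? x) ys)
  #> x ys = length (filter (x Fin.<?_) ys)

  -- In an increasing list the head has nothing below it and the whole tail above it, while for
  -- every later element the head adds one to the count below. So each rank occurs exactly once.
  ∑-select-ranks : ∀ (f : ℕ → ℕ → ℕ) {xs} → AllPairs Fin._<_ xs →
    ∑ (select xs) (λ (x , ys) → f (#≤ x ys) (#> x ys)) ≡ antidiagonal f (length xs)
  ∑-select-ranks f [] = refl
  ∑-select-ranks f {a ∷ xs} (a< ∷ sorted) = begin
    ∑ (select (a ∷ xs)) (λ (x , ys) → f (#≤ x ys) (#> x ys))
      ≡⟨ ∑-select-∷ a xs _ ⟩
    f (#≤ a xs) (#> a xs) + ∑ (select xs) (λ (x , ys) → f (#≤ x (a ∷ ys)) (#> x (a ∷ ys)))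
      ≡⟨ cong₂ _+_
           (cong₂ f (cong length (filter-none (Fin._≤? a) (All.map ℕ.<⇒≱ a<)))
                    (cong length (filter-all (a Fin.<?_) a<)))
           (∑-cong-All (All.map
             (λ {(x , ys)} (a<x , _) → cong₂ f (cong length (filter-accept (Fin._≤? x) (ℕ.<⇒≤ a<x)))
                                               (cong length (filter-reject (x Fin.<?_) (ℕ.<⇒≯ a<x))))
             (select-All a<))) ⟩
    f 0 (length xs) + ∑ (select xs) (λ (x , ys) → f (suc (#≤ x ys)) (#> x ys))
      ≡⟨ cong (f 0 (length xs) +_) (∑-select-ranks (f ∘ suc) sorted) ⟩
    f 0 (length xs) + antidiagonal (f ∘ suc) (length xs) ∎
    where open ≡-Reasoning

  module _ (x : Fin m) (ys : List (Fin m)) where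

    filter-≰ : filter (¬? ∘ (Fin._≤? x)) ys ≡ filter (x Fin.<?_) ys
    filter-≰ = filter-≐ (¬? ∘ (Fin._≤? x)) (x Fin.<?_) (ℕ.≰⇒> , ℕ.<⇒≱) ys

    filter-≮ : filter (¬? ∘ (x Fin.<?_)) ys ≡ filter (Fin._≤? x) ys
    filter-≮ = filter-≐ (¬? ∘ (x Fin.<?_)) (Fin._≤? x) (ℕ.≮⇒≥ , ℕ.≤⇒≯) ys

  module _ (pivotAt : PivotRule) where

    -- Recursive calls carry accessibility proofs obtained from the parent call, whereas
    -- `comparisons` starts from `<-wellFounded`; this identifies the two.
    comparisonsAcc-irrelevant : ∀ xs a b → comparisonsAcc pivotAt {m} xs a ≡ comparisonsAcc pivotAt xs b
    comparisonsAcc-irrelevant []       a       b       = refl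
    comparisonsAcc-irrelevant (x ∷ xs) (acc r) (acc s) =
      cong₂ _+_ (cong (length rest +_) (comparisonsAcc-irrelevant (filter (Fin._≤? pivot) rest) (r _) (s _)))
                (comparisonsAcc-irrelevant (filter (pivot Fin.<?_) rest) (r _) (s _))
      where
      pivot = lookup (x ∷ xs) (pivotAt (length xs))
      rest  = removeAt (x ∷ xs) (pivotAt (length xs))

    splitComparisons : ℕ → Fin m → List (Fin m) → ℕ
    splitComparisons n x ys =
      n + (comparisons pivotAt (filter (Fin._≤? x) ys) + comparisons pivotAt (filter (x Fin.<?_) ys))

    comparisons-split : ∀ n w (e : suc n ≡ length w) → comparisons pivotAt w ≡
      splitComparisons n (lookup w (cast e (pivotAt n))) (removeAt w (cast e (pivotAt n)))
    comparisons-split n (x ∷ xs) refl rewrite Fin.cast-is-id refl (pivotAt (length xs)) = begin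
      comparisons pivotAt (x ∷ xs)
        ≡⟨ cong₂ _+_ (cong₂ _+_ (length-removeAt (x ∷ xs) (pivotAt (length xs))) (comparisonsAcc-irrelevant left _ _))
                     (comparisonsAcc-irrelevant right _ _) ⟩
      length xs + comparisons pivotAt left + comparisons pivotAt right
        ≡⟨ ℕ.+-assoc (length xs) _ _ ⟩
      splitComparisons (length xs) pivot rest ∎
      where
      open ≡-Reasoning
      pivot = lookup (x ∷ xs) (pivotAt (length xs))
      rest  = removeAt (x ∷ xs) (pivotAt (length xs))
      left  = filter (Fin._≤? pivot) rest
      right = filter (pivot Fin.<?_) rest

    -- Stated for every increasing list and not only for `allFin n`, because the induction passes to
    -- the parts on either side of a pivot, which are again increasing.
    permSum-comparisons : ∀ n xs → length xs ≡ n → AllPairs Fin._<_ xs →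
      permSum n xs (comparisons pivotAt) ≡ quicksortTotal n
    permSum-comparisons = <-rec _ step
      where
      open ≡-Reasoning
      weight : ℕ → ℕ → ℕ
      weight l r = rising l r · quicksortTotal l

      step : ∀ n → (∀ {k} → k < n → ∀ xs → length xs ≡ k → AllPairs Fin._<_ xs →
                     permSum k xs (comparisons pivotAt) ≡ quicksortTotal k) →
             ∀ xs → length xs ≡ n → AllPairs Fin._<_ xs → permSum n xs (comparisons pivotAt) ≡ quicksortTotal n
      step zero    ih xs e sorted = refl
      step (suc n) ih xs e sorted = begin
        permSum (suc n) xs (comparisons pivotAt)
          ≡⟨ permSum-removeAt n (pivotAt n) xs (comparisons pivotAt) (splitComparisons n) (comparisons-split n) ⟩
        ∑ (select xs) (λ (x , ys) → permSum n ys (splitComparisons n x))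
          ≡⟨ ∑-cong-All (All.map (λ {(x , ys)} (l , s) → term x ys (ℕ.suc-injective (trans l e)) s)
               (All.zip (select-length xs , select-AllPairs sorted))) ⟩
        ∑ (select xs) (λ (x , ys) → f (#≤ x ys) (#> x ys))
          ≡⟨ ∑-select-ranks f sorted ⟩
        antidiagonal f (length xs)
          ≡⟨ cong (antidiagonal f) e ⟩
        antidiagonal f (suc n)
          ≡⟨ antidiagonal-+ (suc n) (λ _ _ → n ! · n) (λ l r → weight l r + weight r l) ⟩
        antidiagonal (λ _ _ → n ! · n) (suc n) + antidiagonal (λ l r → weight l r + weight r l) (suc n)
          ≡⟨ cong₂ _+_ (antidiagonal-const (suc n) (n ! · n)) (antidiagonal-+ (suc n) weight (flip weight)) ⟩
        suc n · (n ! · n) + (antidiagonal weight (suc n) + antidiagonal (flip weight) (suc n))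
          -- By symmetry of the split, the right parts contribute as much in total as the left
          -- parts.
          ≡⟨ cong (λ z → suc n · (n ! · n) + (antidiagonal weight (suc n) + z)) (antidiagonal-flip (suc n) weight) ⟩
        suc n · (n ! · n) + (antidiagonal weight (suc n) + antidiagonal weight (suc n))
          ≡⟨ cong (λ z → suc n · (n ! · n) + (z + z)) (antidiagonal-quicksortTotal n) ⟩
        suc n · (n ! · n) + (quicksortSum n + quicksortSum n)
          ≡⟨ collect n (n !) (quicksortSum n) ⟩
        quicksortTotal (suc n) ∎
        where
        f : ℕ → ℕ → ℕ
        f l r = n ! · n + (weight l r + weight r l)

        collect : ∀ n f x → suc n · (f · n) + (x + x) ≡ n · (suc n · f) + 2 · x
        collect = solve-∀

        module _ (x : Fin m) (ys : List (Fin m)) (l : length ys ≡ n) (sorted : AllPairs Fin._<_ ys) where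

          part : ∀ {P : Pred (Fin m) 0ℓ} (P? : Decidable P) →
            permSum n ys (comparisons pivotAt ∘ filter P?) ≡
            weight (length (filter P? ys)) (length (filter (¬? ∘ P?) ys))
          part P? = trans (permSum-filter P? n ys (comparisons pivotAt) l)
            (cong (rising (length (filter P? ys)) (length (filter (¬? ∘ P?) ys)) ·_)
              -- The pivot is already missing from `ys`, so any filtered part is strictly shorter
              -- than the list of length `suc n`.
              (ih (s≤s (subst (length (filter P? ys) ≤_) l (length-filter P? ys)))
                  (filter P? ys) refl (AllPairs.filter⁺ P? sorted)))

          term : permSum n ys (splitComparisons n x) ≡ f (#≤ x ys) (#> x ys)
          term = begin
            permSum n ys (splitComparisons n x)
              ≡⟨ permSum-+ n ys (λ _ → n) _ ⟩
            permSum n ys (λ _ → n) + permSum n ys _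
              ≡⟨ cong₂ _+_ (permSum-const n ys n l) (permSum-+ n ys _ _) ⟩
            n ! · n + (permSum n ys (comparisons pivotAt ∘ filter (Fin._≤? x)) +
                       permSum n ys (comparisons pivotAt ∘ filter (x Fin.<?_)))
              ≡⟨ cong (n ! · n +_) (cong₂ _+_
                   (trans (part (Fin._≤? x)) (cong (weight (#≤ x ys) ∘ length) (filter-≰ x ys)))
                   (trans (part (x Fin.<?_)) (cong (weight (#> x ys) ∘ length) (filter-≮ x ys)))) ⟩
            f (#≤ x ys) (#> x ys) ∎

A-quicksortTotal : ∀ pivotAt n → A pivotAt n ≡ quicksortTotal n
A-quicksortTotal pivotAt n = begin
  ∑ (orderings n) (comparisons pivotAt ∘ Vec.toList)
    ≡⟨ ∑-cong (orderings n) (λ w → cong (comparisons pivotAt ∘ Vec.toList) (Vec.map-id w)) ⟨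
  ∑ (orderings n) (λ w → comparisons pivotAt (Vec.toList (Vec.map id w)))
    ≡⟨ ∑-orderings n id (comparisons pivotAt) ⟩
  permSum n (allFin n) (comparisons pivotAt)
    ≡⟨ permSum-comparisons pivotAt n (allFin n) (length-tabulate id) (AllPairs.tabulate⁺-< id) ⟩
  quicksortTotal n ∎
  where open ≡-Reasoning

-- Parking

𝟙-yes : ∀ {P : Set} (P? : Dec P) → P → 𝟙 P? ≡ 1
𝟙-yes P? p = cong (if_then 1 else 0) (dec-true P? p)

𝟙-no : ∀ {P : Set} (P? : Dec P) → ¬ P → 𝟙 P? ≡ 0
𝟙-no P? ¬p = cong (if_then 1 else 0) (dec-false P? ¬p)

𝟙-¬ : ∀ {P : Set} (P? : Dec P) → 𝟙 P? + 𝟙 (¬? P?) ≡ 1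
𝟙-¬ (yes _) = refl
𝟙-¬ (no _)  = refl

∑-allFin-suc : ∀ {n} (f : Fin (suc n) → ℕ) → ∑ (allFin (suc n)) f ≡ f zero + ∑ (allFin n) (f ∘ suc)
∑-allFin-suc {n} f = cong (f zero +_)
  (trans (cong (λ xs → ∑ xs f) (sym (map-tabulate id suc))) (∑-map suc (allFin n) f))

∑-allFin-const : ∀ n c → ∑ (allFin n) (λ _ → c) ≡ n · c
∑-allFin-const n c = trans (∑-const (allFin n) c) (cong (_· c) (length-tabulate {n = n} id))

∑-allFin-≟ : ∀ {n} (s : Fin n) c → ∑ (allFin n) (λ q → 𝟙 (q Fin.≟ s) · c) ≡ c
∑-allFin-≟ {suc n} zero c = begin
  ∑ (allFin (suc n)) (λ q → 𝟙 (q Fin.≟ zero) · c)  ≡⟨ ∑-allFin-suc {n} (λ q → 𝟙 (q Fin.≟ zero) · c) ⟩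
  1 · c + ∑ (allFin n) (λ _ → 0)                   ≡⟨ cong (1 · c +_) (∑-allFin-const n 0) ⟩
  1 · c + n · 0                                    ≡⟨ simplify n c ⟩
  c                                                ∎
  where
  open ≡-Reasoning
  simplify : ∀ n c → 1 · c + n · 0 ≡ c
  simplify = solve-∀
∑-allFin-≟ {suc n} (suc s) c = trans (∑-allFin-suc (λ q → 𝟙 (q Fin.≟ suc s) · c)) (∑-allFin-≟ s c)

∑-allFin-ranks : ∀ n (f : ℕ → ℕ → ℕ) →
  ∑ (allFin n) (λ p → f (∑ (allFin n) (λ q → 𝟙 (q Fin.<? p))) (∑ (allFin n) (λ q → 𝟙 (p Fin.≤? q)))) ≡
  antidiagonal (λ d r → f d (suc r)) n
∑-allFin-ranks zero    f = refl
∑-allFin-ranks (suc n) f = begin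
  ∑ (allFin (suc n)) (λ p → f (before p) (after p))
    ≡⟨ ∑-allFin-suc (λ p → f (before p) (after p)) ⟩
  f (before zero) (after zero) + ∑ (allFin n) (λ p → f (before (suc p)) (after (suc p)))
    ≡⟨ cong₂ _+_ (cong₂ f before-zero after-zero) (∑-cong (allFin n) λ p → cong₂ f (before-suc p) (after-suc p)) ⟩
  f 0 (suc n) + ∑ (allFin n) (λ p → f (suc (∑ (allFin n) (λ q → 𝟙 (q Fin.<? p)))) (∑ (allFin n) (λ q → 𝟙 (p Fin.≤? q))))
    ≡⟨ cong (f 0 (suc n) +_) (∑-allFin-ranks n (f ∘ suc)) ⟩
  antidiagonal (λ d r → f d (suc r)) (suc n) ∎
  where
  open ≡-Reasoning
  before after : Fin (suc n) → ℕ
  before p = ∑ (allFin (suc n)) (λ q → 𝟙 (q Fin.<? p))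
  after  p = ∑ (allFin (suc n)) (λ q → 𝟙 (p Fin.≤? q))
  before-zero : before zero ≡ 0
  before-zero = trans (∑-allFin-const (suc n) 0) (ℕ.*-zeroʳ (suc n))
  after-zero : after zero ≡ suc n
  after-zero = trans (∑-allFin-const (suc n) 1) (ℕ.*-identityʳ (suc n))
  before-suc : ∀ p → before (suc p) ≡ suc (∑ (allFin n) (λ q → 𝟙 (q Fin.<? p)))
  before-suc p = ∑-allFin-suc {n} (λ q → 𝟙 (q Fin.<? suc p))
  -- Splitting on `p` lets the two Boolean tests compute to the same result.
  ≤?-suc : ∀ {n} (p q : Fin n) → 𝟙 (suc p Fin.≤? suc q) ≡ 𝟙 (p Fin.≤? q)
  ≤?-suc zero    q = refl
  ≤?-suc (suc p) q = refl
  after-suc : ∀ p → after (suc p) ≡ ∑ (allFin n) (λ q → 𝟙 (p Fin.≤? q))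
  after-suc p = trans (∑-allFin-suc {n} (λ q → 𝟙 (suc p Fin.≤? q))) (∑-cong (allFin n) (≤?-suc p))

find-just : ∀ {P : Pred I 0ℓ} (P? : Decidable P) xs {x} → find P? xs ≡ just x → P x
find-just P? (y ∷ xs) e with P? y
find-just P? (y ∷ xs) refl | yes Py = Py
...                        | no _   = find-just P? xs e

find-nothing : ∀ {P : Pred I 0ℓ} (P? : Decidable P) xs → find P? xs ≡ nothing → All (¬_ ∘ P) xs
find-nothing P? []       e = []
find-nothing P? (y ∷ xs) e with P? y
... | no ¬Py = ¬Py ∷ find-nothing P? xs e

find-tabulate : ∀ {n} {P : Pred I 0ℓ} (P? : Decidable P) (f : Fin n → I) i →
  P (f i) → (∀ {j} → j Fin.< i → ¬ P (f j)) → find P? (tabulate f) ≡ just (f i)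
find-tabulate P? f zero    Pi first rewrite dec-true (P? (f zero)) Pi = refl
find-tabulate P? f (suc i) Pi first rewrite dec-false (P? (f zero)) (first (s≤s z≤n)) =
  find-tabulate P? (f ∘ suc) i Pi (first ∘ s≤s)

luckyFrom-∷ : ∀ {n k} (occ : Subset n) p (w : Vec (Fin n) k) {s} → parkingSpot occ p ≡ just s →
  luckyFrom occ (p ∷ w) ≡ 𝟙 (s Fin.≟ p) + luckyFrom (occ ∪ ⁅ s ⁆) w
luckyFrom-∷ occ p w e rewrite e = refl

-- Free spots and the parking rule

module _ {n : ℕ} where

  -- Occupied spots get weight 0 instead of being dropped, so that sums for different `occ` range
  -- over the same list and can be interchanged and compared termwise.
  freeSum : Subset n → (Fin n → ℕ) → ℕ
  freeSum occ φ = ∑ (allFin n) (λ q → 𝟙 (¬? (q ∈? occ)) · φ q)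

  freeSum-cong : ∀ occ {φ ψ} → (∀ q → q ∉ occ → φ q ≡ ψ q) → freeSum occ φ ≡ freeSum occ ψ
  freeSum-cong occ {φ} {ψ} eq = ∑-cong (allFin n) λ q → term q (q ∈? occ)
    where
    term : ∀ q (d : Dec (q ∈ occ)) → 𝟙 (¬? d) · φ q ≡ 𝟙 (¬? d) · ψ q
    term q (yes _)  = refl
    term q (no q∉) = cong (1 ·_) (eq q q∉)

  freeSum-+ : ∀ occ φ ψ → freeSum occ (λ q → φ q + ψ q) ≡ freeSum occ φ + freeSum occ ψ
  freeSum-+ occ φ ψ = trans
    (∑-cong (allFin n) λ q → ℕ.*-distribˡ-+ (𝟙 (¬? (q ∈? occ))) (φ q) (ψ q))
    (∑-+ (allFin n) (λ q → 𝟙 (¬? (q ∈? occ)) · φ q) (λ q → 𝟙 (¬? (q ∈? occ)) · ψ q))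

  freeSum-*ʳ : ∀ occ φ c → freeSum occ (λ q → φ q · c) ≡ freeSum occ φ · c
  freeSum-*ʳ occ φ c = trans
    (∑-cong (allFin n) λ q → sym (ℕ.*-assoc (𝟙 (¬? (q ∈? occ))) (φ q) c))
    (∑-*ʳ (allFin n) c (λ q → 𝟙 (¬? (q ∈? occ)) · φ q))

  freeSum-⊥ : ∀ φ → freeSum ⊥ φ ≡ ∑ (allFin n) φ
  freeSum-⊥ φ = ∑-cong (allFin n) λ q →
    trans (cong (_· φ q) (𝟙-yes (¬? (q ∈? ⊥)) ∉⊥)) (ℕ.*-identityˡ (φ q))

  -- The bookkeeping of one parked car: with `φ` constantly 1 it lowers the number of free spots by
  -- one, with an indicator it tells which of `#free≥` and `#free<` drops.
  freeSum-∪ : ∀ {occ s} → s ∉ occ → ∀ φ → freeSum occ φ ≡ φ s + freeSum (occ ∪ ⁅ s ⁆) φ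
  freeSum-∪ {occ} {s} s∉ φ = begin
    freeSum occ φ
      ≡⟨ ∑-cong (allFin n) term ⟩
    ∑ (allFin n) (λ q → 𝟙 (q Fin.≟ s) · φ s + 𝟙 (¬? (q ∈? (occ ∪ ⁅ s ⁆))) · φ q)
      ≡⟨ ∑-+ (allFin n) (λ q → 𝟙 (q Fin.≟ s) · φ s) _ ⟩
    ∑ (allFin n) (λ q → 𝟙 (q Fin.≟ s) · φ s) + freeSum (occ ∪ ⁅ s ⁆) φ
      ≡⟨ cong (_+ freeSum (occ ∪ ⁅ s ⁆) φ) (∑-allFin-≟ s (φ s)) ⟩
    φ s + freeSum (occ ∪ ⁅ s ⁆) φ ∎
    where
    open ≡-Reasoning
    term : ∀ q → 𝟙 (¬? (q ∈? occ)) · φ q ≡ 𝟙 (q Fin.≟ s) · φ s + 𝟙 (¬? (q ∈? (occ ∪ ⁅ s ⁆))) · φ q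
    term q with q Fin.≟ s | q ∈? occ | q ∈? (occ ∪ ⁅ s ⁆)
    ... | yes refl | yes s∈ | _     = contradiction s∈ s∉
    ... | yes refl | no _   | yes _ = sym (ℕ.+-identityʳ _)
    ... | yes refl | no _   | no ∉∪ = contradiction (x∈p∪q⁺ (inj₂ (x∈⁅x⁆ s))) ∉∪
    ... | no _     | yes _  | yes _ = refl
    ... | no _     | yes q∈ | no ∉∪ = contradiction (x∈p∪q⁺ (inj₁ q∈)) ∉∪
    ... | no _     | no _   | no _  = refl
    ... | no q≢s   | no q∉  | yes ∈∪ with x∈p∪q⁻ occ ⁅ s ⁆ ∈∪
    ...   | inj₁ q∈ = contradiction q∈ q∉
    ...   | inj₂ q∈ = contradiction (x∈⁅y⁆⇒x≡y s q∈) q≢s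

  #free #occupied : Subset n → ℕ
  #free     occ = freeSum occ (λ _ → 1)
  #occupied occ = ∑ (allFin n) (λ q → 𝟙 (q ∈? occ))

  #free≥ #free< : Fin n → Subset n → ℕ
  #free≥ p occ = freeSum occ (λ q → 𝟙 (p Fin.≤? q))
  #free< p occ = freeSum occ (λ q → 𝟙 (q Fin.<? p))

  freeSum-const : ∀ occ c → freeSum occ (λ _ → c) ≡ #free occ · c
  freeSum-const occ c = trans (freeSum-cong occ λ _ _ → sym (ℕ.*-identityˡ c)) (freeSum-*ʳ occ (λ _ → 1) c)

  #occupied+#free : ∀ occ → #occupied occ + #free occ ≡ n
  #occupied+#free occ = begin
    #occupied occ + #free occ
      ≡⟨ ∑-+ (allFin n) (λ q → 𝟙 (q ∈? occ)) _ ⟨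
    ∑ (allFin n) (λ q → 𝟙 (q ∈? occ) + 𝟙 (¬? (q ∈? occ)) · 1)
      ≡⟨ ∑-cong (allFin n) (λ q → trans (cong (𝟙 (q ∈? occ) +_) (ℕ.*-identityʳ _)) (𝟙-¬ (q ∈? occ))) ⟩
    ∑ (allFin n) (λ _ → 1)
      ≡⟨ trans (∑-allFin-const n 1) (ℕ.*-identityʳ n) ⟩
    n ∎
    where open ≡-Reasoning

  𝟙-≤-< : ∀ (p q : Fin n) → 𝟙 (p Fin.≤? q) + 𝟙 (q Fin.<? p) ≡ 1
  𝟙-≤-< p q with p Fin.≤? q
  ... | yes p≤q = cong₂ _+_ (𝟙-yes (p Fin.≤? q) p≤q) (𝟙-no (q Fin.<? p) (ℕ.≤⇒≯ p≤q))
  ... | no p≰q  = cong₂ _+_ (𝟙-no (p Fin.≤? q) p≰q) (𝟙-yes (q Fin.<? p) (ℕ.≰⇒> p≰q))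

  #free≥+#free< : ∀ p occ → #free≥ p occ + #free< p occ ≡ #free occ
  #free≥+#free< p occ = trans (sym (freeSum-+ occ (λ q → 𝟙 (p Fin.≤? q)) (λ q → 𝟙 (q Fin.<? p))))
                              (freeSum-cong occ λ q _ → 𝟙-≤-< p q)

  #free≥-∃ : ∀ {occ p s} → p Fin.≤ s → s ∉ occ → #free≥ p occ ≢ 0
  #free≥-∃ {occ} {p} {s} p≤s s∉ e
    with () ← trans (sym e) (trans (freeSum-∪ s∉ (λ q → 𝟙 (p Fin.≤? q)))
      (cong (_+ #free≥ p (occ ∪ ⁅ s ⁆)) (𝟙-yes (p Fin.≤? s) p≤s)))

  parkingSpot-free : ∀ {occ : Subset n} {p} → p ∉ occ → parkingSpot occ p ≡ just p
  parkingSpot-free {occ} {p} p∉ =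
    find-tabulate (λ s → (p Fin.≤? s) ×-dec ¬? (s ∈? occ)) id p (ℕ.≤-refl , p∉)
      (λ j<p (p≤j , _) → ℕ.<⇒≱ j<p p≤j)

  parkingSpot-just : ∀ {occ : Subset n} {p s} → parkingSpot occ p ≡ just s → p Fin.≤ s × s ∉ occ
  parkingSpot-just = find-just _ (allFin n)

  parkingSpot-nothing : ∀ {occ : Subset n} {p} → parkingSpot occ p ≡ nothing → #free≥ p occ ≡ 0
  parkingSpot-nothing {occ} {p} e = begin
    #free≥ p occ            ≡⟨ ∑-cong-All (All.map (λ {q} → term q) (find-nothing _ (allFin n) e)) ⟩
    ∑ (allFin n) (λ _ → 0)  ≡⟨ trans (∑-allFin-const n 0) (ℕ.*-zeroʳ n) ⟩
    0                       ∎
    where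
    open ≡-Reasoning
    term : ∀ q → ¬ (p Fin.≤ q × q ∉ occ) → 𝟙 (¬? (q ∈? occ)) · 𝟙 (p Fin.≤? q) ≡ 0
    term q none with q ∈? occ
    ... | yes _  = refl
    ... | no q∉ = trans (ℕ.*-identityˡ _) (𝟙-no (p Fin.≤? q) (λ p≤q → none (p≤q , q∉)))

  luckyFrom-free : ∀ {k occ p} (w : Vec (Fin n) k) → p ∉ occ →
                   luckyFrom occ (p ∷ w) ≡ suc (luckyFrom (occ ∪ ⁅ p ⁆) w)
  luckyFrom-free {occ = occ} {p} w p∉ = trans (luckyFrom-∷ occ p w (parkingSpot-free p∉))
    (cong (_+ luckyFrom (occ ∪ ⁅ p ⁆) w) (𝟙-yes (p Fin.≟ p) refl))

  luckyFrom-≤ : ∀ {k} occ (w : Vec (Fin n) k) → luckyFrom occ w ≤ k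
  luckyFrom-≤ occ []      = z≤n
  luckyFrom-≤ occ (p ∷ w) with parkingSpot occ p
  ... | nothing = ℕ.m≤n⇒m≤1+n (luckyFrom-≤ occ w)
  ... | just s  with does (s Fin.≟ p)
  ...   | true  = s≤s (luckyFrom-≤ _ w)
  ...   | false = ℕ.m≤n⇒m≤1+n (luckyFrom-≤ _ w)

  -- Counting words by their number of lucky cars

  #lucky : Subset n → ℕ → ℕ → ℕ
  #lucky occ k t = ∑ (words n k) (λ w → 𝟙 (luckyFrom occ w ℕ.≟ t))

  #lucky-∷ : Subset n → ℕ → ℕ → Fin n → ℕ
  #lucky-∷ occ k t p = ∑ (words n k) (λ w → 𝟙 (luckyFrom occ (p ∷ w) ℕ.≟ t))

  #lucky-suc : ∀ occ k t → #lucky occ (suc k) t ≡ ∑ (allFin n) (#lucky-∷ occ k t)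
  #lucky-suc occ k t = ∑-cartesianProductWith _∷_ (allFin n) (words n k) _

  -- A car whose preference is taken is unlucky whether it parks further on or fails, so the later
  -- cars must supply all `t` lucky ones.
  #lucky-∷-occupied : ∀ {occ p} → p ∈ occ → ∀ k t →
    #lucky-∷ occ k t p ≡ maybe′ (λ s → #lucky (occ ∪ ⁅ s ⁆) k t) (#lucky occ k t) (parkingSpot occ p)
  #lucky-∷-occupied {occ} {p} p∈ k t with parkingSpot occ p in e
  ... | nothing = refl
  ... | just s rewrite dec-false (s Fin.≟ p) (λ { refl → proj₂ (parkingSpot-just e) p∈ }) = refl

  #lucky-excess : ∀ occ k → #lucky occ k (suc k) ≡ 0
  #lucky-excess occ k = begin
    #lucky occ k (suc k)
      ≡⟨ ∑-cong (words n k) (λ w → 𝟙-no (luckyFrom occ w ℕ.≟ suc k) (ℕ.<⇒≢ (s≤s (luckyFrom-≤ occ w)))) ⟩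
    ∑ (words n k) (λ _ → 0)
      ≡⟨ trans (∑-const (words n k) 0) (ℕ.*-zeroʳ (length (words n k))) ⟩
    0 ∎
    where open ≡-Reasoning

  -- If the first car were unlucky, too few cars would remain. So it takes one of the free spots,
  -- which leaves `d` surplus spots for the others; the factor d! replaces the division in (d + k)!
  -- / d!.
  #lucky-all : ∀ d k occ → #free occ ≡ d + k → #lucky occ k k · d ! ≡ (d + k) !
  #lucky-all d zero    occ e = trans (ℕ.+-identityʳ (d !)) (cong _! (sym (ℕ.+-identityʳ d)))
  #lucky-all d (suc k) occ e = begin
    #lucky occ (suc k) (suc k) · d !
      ≡⟨ cong (_· d !) (#lucky-suc occ k (suc k)) ⟩
    ∑ (allFin n) (#lucky-∷ occ k (suc k)) · d !
      ≡⟨ ∑-*ʳ (allFin n) (d !) _ ⟨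
    ∑ (allFin n) (λ p → #lucky-∷ occ k (suc k) p · d !)
      ≡⟨ ∑-cong (allFin n) (λ p → term p (p ∈? occ)) ⟩
    freeSum occ (λ _ → (d + k) !)
      ≡⟨ freeSum-const occ ((d + k) !) ⟩
    #free occ · (d + k) !
      ≡⟨ cong (_· (d + k) !) (trans e (ℕ.+-suc d k)) ⟩
    suc (d + k) !
      ≡⟨ cong _! (ℕ.+-suc d k) ⟨
    (d + suc k) ! ∎
    where
    open ≡-Reasoning
    term : ∀ p (dec : Dec (p ∈ occ)) → #lucky-∷ occ k (suc k) p · d ! ≡ 𝟙 (¬? dec) · (d + k) !
    term p (yes p∈) = cong (_· d !) (trans (#lucky-∷-occupied p∈ k (suc k)) none)
      where
      none : maybe′ (λ s → #lucky (occ ∪ ⁅ s ⁆) k (suc k)) (#lucky occ k (suc k)) (parkingSpot occ p) ≡ 0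
      none with parkingSpot occ p
      ... | nothing = #lucky-excess occ k
      ... | just s  = #lucky-excess (occ ∪ ⁅ s ⁆) k
    term p (no p∉) = begin
      #lucky-∷ occ k (suc k) p · d !
        ≡⟨ cong (_· d !) (∑-cong (words n k) λ w → cong (λ z → 𝟙 (z ℕ.≟ suc k)) (luckyFrom-free w p∉)) ⟩
      #lucky (occ ∪ ⁅ p ⁆) k k · d !
        ≡⟨ #lucky-all d k (occ ∪ ⁅ p ⁆)
             (ℕ.suc-injective (trans (sym (freeSum-∪ p∉ (λ _ → 1))) (trans e (ℕ.+-suc d k)))) ⟩
      (d + k) !
        ≡⟨ ℕ.*-identityˡ ((d + k) !) ⟨
      1 · (d + k) ! ∎

  -- The successor stands on the left so that no cars give the count 0, where a truncated `k ∸ 1`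
  -- would give 1. For a positive `k` the test computes to the one in `#lucky`.
  #oneUnlucky : Subset n → ℕ → ℕ
  #oneUnlucky occ k = ∑ (words n k) (λ w → 𝟙 (suc (luckyFrom occ w) ℕ.≟ k))

  #lucky-∷-unlucky : ∀ {occ p k} → p ∈ occ → #free occ ≡ suc k →
    #lucky-∷ occ k k p ≡ k ! + 𝟙 (#free≥ p occ ℕ.≟ 0) · (k · k !)
  #lucky-∷-unlucky {occ} {p} {k} p∈ e = trans (#lucky-∷-occupied p∈ k k) cases
    where
    cases : maybe′ (λ s → #lucky (occ ∪ ⁅ s ⁆) k k) (#lucky occ k k) (parkingSpot occ p)
            ≡ k ! + 𝟙 (#free≥ p occ ℕ.≟ 0) · (k · k !)
    cases with parkingSpot occ p in spot
    ... | nothing rewrite 𝟙-yes (#free≥ p occ ℕ.≟ 0) (parkingSpot-nothing spot) =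
      -- The car fails, so there is one more free spot than cars to come: (k + 1)! = k! + k k!
      -- continuations.
      trans (sym (ℕ.*-identityʳ _)) (trans (#lucky-all 1 k occ e) (cong (k ! +_) (sym (ℕ.*-identityˡ (k · k !)))))
    ... | just s with p≤s , s∉ ← parkingSpot-just spot
                 rewrite 𝟙-no (#free≥ p occ ℕ.≟ 0) (#free≥-∃ p≤s s∉) =
      -- The car takes `s`, so exactly as many free spots as cars remain: k! continuations.
      trans (sym (ℕ.*-identityʳ _))
        (trans (#lucky-all 0 k (occ ∪ ⁅ s ⁆) (ℕ.suc-injective (trans (sym (freeSum-∪ s∉ (λ _ → 1))) e)))
               (sym (ℕ.+-identityʳ (k !))))

  -- The surplus can be written without a factor for `p ∈ occ`: if `p` is free, it is itself a free
  -- spot from `p` on, and the indicator vanishes. The surplus thus depends on `occ` only through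
  -- `#free≥` and k.
  #lucky-∷-cases : ∀ occ k p → #free occ ≡ suc k → #lucky-∷ occ k k p ≡
    𝟙 (¬? (p ∈? occ)) · #oneUnlucky (occ ∪ ⁅ p ⁆) k +
    (𝟙 (p ∈? occ) · k ! + 𝟙 (#free≥ p occ ℕ.≟ 0) · (k · k !))
  #lucky-∷-cases occ k p e with p ∈? occ
  ... | yes p∈ = trans (#lucky-∷-unlucky p∈ e)
    (cong (_+ 𝟙 (#free≥ p occ ℕ.≟ 0) · (k · k !)) (sym (ℕ.*-identityˡ (k !))))
  ... | no p∉ rewrite 𝟙-no (#free≥ p occ ℕ.≟ 0) (#free≥-∃ {p = p} ℕ.≤-refl p∉) =
    trans (∑-cong (words n k) λ w → cong (λ z → 𝟙 (z ℕ.≟ k)) (luckyFrom-free w p∉))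
          (sym (trans (ℕ.+-identityʳ _) (ℕ.*-identityˡ _)))

  -- The recursion of `tailWeight` in one formula. Truncated predecessors occur only with a
  -- vanishing factor, and for `r` zero the hypothesis makes `k` one less than `d`, as in the
  -- definition's surplus.
  tailWeight-step : ∀ {k} r d → r + d ≡ suc k →
    r · tailWeight (r ∸ 1) d + d · tailWeight r (d ∸ 1) + 𝟙 (r ℕ.≟ 0) · (k · k !) ≡ tailWeight r d
  tailWeight-step zero    (suc d) refl = swap (d · d !) (suc d · tailWeight 0 d)
    where
    swap : ∀ a b → b + 1 · a ≡ a + b
    swap = solve-∀
  tailWeight-step (suc r) d e =
    trans (ℕ.+-identityʳ _) (sym (tailWeight-suc r d))

  -- A lucky car on `q` lowers the count from `p` on if `p ≤ q`, and the count before `p` otherwise.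
  -- There are r spots of the first kind and d of the second, which reproduces the recursion of
  -- `tailWeight`.
  freeSum-tailWeight : ∀ {k} occ p → #free occ ≡ suc k →
    freeSum occ (λ q → tailWeight (#free≥ p (occ ∪ ⁅ q ⁆)) (#free< p (occ ∪ ⁅ q ⁆))) +
      𝟙 (#free≥ p occ ℕ.≟ 0) · (k · k !) ≡
    tailWeight (#free≥ p occ) (#free< p occ)
  freeSum-tailWeight {k} occ p e = begin
    freeSum occ (λ q → tailWeight (#free≥ p (occ ∪ ⁅ q ⁆)) (#free< p (occ ∪ ⁅ q ⁆))) + c
      ≡⟨ cong (_+ c) (freeSum-cong occ term) ⟩
    freeSum occ (λ q → 𝟙 (p Fin.≤? q) · tailWeight (r ∸ 1) d + 𝟙 (q Fin.<? p) · tailWeight r (d ∸ 1)) + c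
      ≡⟨ cong (_+ c) (freeSum-+ occ (λ q → 𝟙 (p Fin.≤? q) · tailWeight (r ∸ 1) d) _) ⟩
    freeSum occ (λ q → 𝟙 (p Fin.≤? q) · tailWeight (r ∸ 1) d) + freeSum occ (λ q → 𝟙 (q Fin.<? p) · tailWeight r (d ∸ 1)) + c
      ≡⟨ cong₂ (λ x y → x + y + c) (freeSum-*ʳ occ (λ q → 𝟙 (p Fin.≤? q)) _) (freeSum-*ʳ occ (λ q → 𝟙 (q Fin.<? p)) _) ⟩
    r · tailWeight (r ∸ 1) d + d · tailWeight r (d ∸ 1) + c
      ≡⟨ tailWeight-step r d (trans (#free≥+#free< p occ) e) ⟩
    tailWeight r d ∎
    where
    open ≡-Reasoning
    r = #free≥ p occ
    d = #free< p occ
    c = 𝟙 (r ℕ.≟ 0) · (k · k !)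
    term : ∀ q → q ∉ occ → tailWeight (#free≥ p (occ ∪ ⁅ q ⁆)) (#free< p (occ ∪ ⁅ q ⁆)) ≡
           𝟙 (p Fin.≤? q) · tailWeight (r ∸ 1) d + 𝟙 (q Fin.<? p) · tailWeight r (d ∸ 1)
    -- After rewriting, the old counts are an indicator plus the new counts, and exactly one of the
    -- two indicators is 1; `∸ 1` removes that one.
    term q q∉ rewrite freeSum-∪ q∉ (λ q → 𝟙 (p Fin.≤? q)) | freeSum-∪ q∉ (λ q → 𝟙 (q Fin.<? p))
      with 𝟙 (p Fin.≤? q) | 𝟙 (q Fin.<? p) | 𝟙-≤-< p q
    ... | 0 | _ | refl = sym (ℕ.*-identityˡ _)
    ... | 1 | _ | refl = sym (trans (ℕ.+-identityʳ _) (ℕ.*-identityˡ _))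

  -- As long as every car has been lucky, as many cars as free spots are left, so one `k` serves for
  -- both. The next car is either lucky, which is the induction hypothesis with `m` raised by one,
  -- or the unlucky one, which gives m k! for the occupied preferences plus the surplus for each
  -- `p`.
  #oneUnlucky-weights : ∀ k m occ → m + k ≡ n → #free occ ≡ k →
    #oneUnlucky occ k ≡ unluckyWeight k m + ∑ (allFin n) (λ p → tailWeight (#free≥ p occ) (#free< p occ))
  #oneUnlucky-weights zero m occ m+0≡n e = sym (begin
    ∑ (allFin n) (λ p → tailWeight (#free≥ p occ) (#free< p occ))
      ≡⟨ ∑-cong (allFin n) (λ p → let s = trans (#free≥+#free< p occ) e in
           cong₂ tailWeight (ℕ.m+n≡0⇒m≡0 (#free≥ p occ) s) (ℕ.m+n≡0⇒n≡0 (#free≥ p occ) s)) ⟩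
    ∑ (allFin n) (λ _ → 0)
      ≡⟨ trans (∑-allFin-const n 0) (ℕ.*-zeroʳ n) ⟩
    0 ∎)
    where open ≡-Reasoning
  #oneUnlucky-weights (suc k) m occ m+k≡n e = begin
    #oneUnlucky occ (suc k)
      ≡⟨ #lucky-suc occ k k ⟩
    ∑ (allFin n) (#lucky-∷ occ k k)
      ≡⟨ ∑-cong (allFin n) (λ p → #lucky-∷-cases occ k p e) ⟩
    ∑ (allFin n) (λ p → 𝟙 (¬? (p ∈? occ)) · #oneUnlucky (occ ∪ ⁅ p ⁆) k +
                        (𝟙 (p ∈? occ) · k ! + full p))
      ≡⟨ ∑-+ (allFin n) (λ p → 𝟙 (¬? (p ∈? occ)) · #oneUnlucky (occ ∪ ⁅ p ⁆) k) _ ⟩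
    freeSum occ (λ p → #oneUnlucky (occ ∪ ⁅ p ⁆) k) + ∑ (allFin n) (λ p → 𝟙 (p ∈? occ) · k ! + full p)
      ≡⟨ cong₂ _+_ (freeSum-cong occ λ q q∉ → #oneUnlucky-weights k (suc m) (occ ∪ ⁅ q ⁆)
                      (trans (sym (ℕ.+-suc m k)) m+k≡n)
                      (ℕ.suc-injective (trans (sym (freeSum-∪ q∉ (λ _ → 1))) e)))
                   (∑-+ (allFin n) (λ p → 𝟙 (p ∈? occ) · k !) full) ⟩
    freeSum occ (λ q → unluckyWeight k (suc m) + ∑ (allFin n) (V q)) +
      (∑ (allFin n) (λ p → 𝟙 (p ∈? occ) · k !) + ∑ (allFin n) full)
      ≡⟨ cong₂ _+_ (freeSum-+ occ (λ _ → unluckyWeight k (suc m)) _)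
                   (cong (_+ ∑ (allFin n) full) (∑-*ʳ (allFin n) (k !) _)) ⟩
    freeSum occ (λ _ → unluckyWeight k (suc m)) + freeSum occ (λ q → ∑ (allFin n) (V q)) +
      (#occupied occ · k ! + ∑ (allFin n) full)
      -- The number of occupied spots is `m`, by cancelling the `suc k` free ones from the total.
      ≡⟨ cong₂ (λ x y → x + freeSum occ (λ q → ∑ (allFin n) (V q)) + (y · k ! + ∑ (allFin n) full))
           (trans (freeSum-const occ _) (cong (_· unluckyWeight k (suc m)) e))
           (ℕ.+-cancelʳ-≡ (suc k) _ _ (trans (cong (#occupied occ +_) (sym e)) (trans (#occupied+#free occ) (sym m+k≡n)))) ⟩
    suc k · unluckyWeight k (suc m) + freeSum occ (λ q → ∑ (allFin n) (V q)) + (m · k ! + ∑ (allFin n) full)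
      ≡⟨ regroup (suc k · unluckyWeight k (suc m)) (freeSum occ (λ q → ∑ (allFin n) (V q))) (m · k !) _ ⟩
    unluckyWeight (suc k) m + (freeSum occ (λ q → ∑ (allFin n) (V q)) + ∑ (allFin n) full)
      ≡⟨ cong (unluckyWeight (suc k) m +_) tails ⟩
    unluckyWeight (suc k) m + ∑ (allFin n) (λ p → tailWeight (#free≥ p occ) (#free< p occ)) ∎
    where
    open ≡-Reasoning
    full : Fin n → ℕ
    full p = 𝟙 (#free≥ p occ ℕ.≟ 0) · (k · k !)
    V : Fin n → Fin n → ℕ
    V q p = tailWeight (#free≥ p (occ ∪ ⁅ q ⁆)) (#free< p (occ ∪ ⁅ q ⁆))
    regroup : ∀ a b c d → a + b + (c + d) ≡ c + a + (b + d)
    regroup = solve-∀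
    -- Exchanging the sums fixes the preference `p` of the unlucky car and lets the spot `q` of the
    -- next lucky car vary, so that `freeSum-tailWeight` applies for each `p`.
    tails : freeSum occ (λ q → ∑ (allFin n) (V q)) + ∑ (allFin n) full
            ≡ ∑ (allFin n) (λ p → tailWeight (#free≥ p occ) (#free< p occ))
    tails = begin
      freeSum occ (λ q → ∑ (allFin n) (V q)) + ∑ (allFin n) full
        ≡⟨ cong (_+ ∑ (allFin n) full) (∑-cong (allFin n) λ q → sym (∑-*ˡ (allFin n) (𝟙 (¬? (q ∈? occ))) (V q))) ⟩
      ∑ (allFin n) (λ q → ∑ (allFin n) (λ p → 𝟙 (¬? (q ∈? occ)) · V q p)) + ∑ (allFin n) full
        ≡⟨ cong (_+ ∑ (allFin n) full) (∑-swap (allFin n) (allFin n) (λ q p → 𝟙 (¬? (q ∈? occ)) · V q p)) ⟩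
      ∑ (allFin n) (λ p → freeSum occ (λ q → V q p)) + ∑ (allFin n) full
        ≡⟨ ∑-+ (allFin n) (λ p → freeSum occ (λ q → V q p)) full ⟨
      ∑ (allFin n) (λ p → freeSum occ (λ q → V q p) + full p)
        ≡⟨ ∑-cong (allFin n) (λ p → freeSum-tailWeight occ p e) ⟩
      ∑ (allFin n) (λ p → tailWeight (#free≥ p occ) (#free< p occ)) ∎

L-weights : ∀ n → L (suc n) ≡ unluckyWeight (suc n) 0 + tailTotal (suc n)
L-weights n = begin
  L (suc n)
    -- For `suc n` cars the target is `n`, and comparing `Lucky α` with `n` computes to the same
    -- Boolean as comparing the successors in `#oneUnlucky`.
    ≡⟨ length-filter-∑ (λ α → Lucky α ℕ.≟ n) (preferenceLists (suc n)) ⟩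
  #oneUnlucky {suc n} ⊥ (suc n)
    ≡⟨ #oneUnlucky-weights (suc n) 0 ⊥ refl
         (trans (freeSum-⊥ {suc n} (λ _ → 1)) (trans (∑-allFin-const (suc n) 1) (ℕ.*-identityʳ (suc n)))) ⟩
  unluckyWeight (suc n) 0 + ∑ (allFin (suc n)) (λ p → tailWeight (#free≥ p ⊥) (#free< p ⊥))
    ≡⟨ cong (unluckyWeight (suc n) 0 +_) (trans
         (∑-cong (allFin (suc n)) λ p → cong₂ tailWeight (freeSum-⊥ {suc n} (λ q → 𝟙 (p Fin.≤? q))) (freeSum-⊥ {suc n} (λ q → 𝟙 (q Fin.<? p))))
         (∑-allFin-ranks (suc n) (flip tailWeight))) ⟩
  unluckyWeight (suc n) 0 + tailTotal (suc n) ∎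
  where open ≡-Reasoning

-- Adds the closed forms of the two weights: n n! and 3 n n! give 4 n n!, and the coefficients n and
-- n + 2 give 2 (n + 1).
L-closed : ∀ n → L (suc n) + 4 · suc n · suc n ! ≡ 2 · suc (suc n) · harmonic! (suc n)
L-closed n′ = begin
  L n + 4 · n · n !
    ≡⟨ cong (_+ 4 · n · n !) (L-weights n′) ⟩
  unluckyWeight n 0 + tailTotal n + 4 · n · n !
    ≡⟨ split n (unluckyWeight n 0) (tailTotal n) (n !) ⟩
  (unluckyWeight n 0 + n · n !) + (tailTotal n + 3 · n · n !)
    ≡⟨ cong₂ _+_ (unluckyWeight-closed n 0) (tailTotal-closed n) ⟩
  n · harmonic! n + (n + 2) · harmonic! n
    ≡⟨ merge n (harmonic! n) ⟩
  2 · suc n · harmonic! n ∎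
  where
  open ≡-Reasoning
  n = suc n′
  split : ∀ n x y f → x + y + 4 · n · f ≡ (x + n · f) + (y + 3 · n · f)
  split = solve-∀
  merge : ∀ n x → n · x + (n + 2) · x ≡ 2 · suc n · x
  merge = solve-∀

-- Rational numbers

-- Moves a quotient to unnormalised fractions, where equations are checked by cross-multiplication
-- without reducing to lowest terms.
toℚᵘ-/ : ∀ i d-1 → ℚ.toℚᵘ (i / suc d-1) ≃ mkℚᵘ i d-1
toℚᵘ-/ i d-1 = ℚ.toℚᵘ-fromℚᵘ (mkℚᵘ i d-1)

fromℕ-+ : ∀ a b → fromℕ (a + b) ≡ fromℕ a ℚ.+ fromℕ b
fromℕ-+ a b = ℚ.toℚᵘ-injective (begin
  ℚ.toℚᵘ (fromℕ (a + b))                    ≈⟨ toℚᵘ-/ (ℤ.+ (a + b)) 0 ⟩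
  mkℚᵘ (ℤ.+ (a + b)) 0                        ≈⟨ *≡* (cong (ℤ._* (ℤ.+ 1)) (cong₂ ℤ._+_ (ℤ.*-identityʳ (ℤ.+ a)) (ℤ.*-identityʳ (ℤ.+ b)))) ⟨
  mkℚᵘ (ℤ.+ a) 0 ℚᵘ.+ mkℚᵘ (ℤ.+ b) 0            ≈⟨ ℚᵘ.+-cong (toℚᵘ-/ (ℤ.+ a) 0) (toℚᵘ-/ (ℤ.+ b) 0) ⟨
  ℚ.toℚᵘ (fromℕ a) ℚᵘ.+ ℚ.toℚᵘ (fromℕ b)    ≈⟨ ℚ.toℚᵘ-homo-+ (fromℕ a) (fromℕ b) ⟨
  ℚ.toℚᵘ (fromℕ a ℚ.+ fromℕ b)              ∎)
  where open import Relation.Binary.Reasoning.Setoid ℚᵘ.≃-setoid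

fromℕ-* : ∀ a b → fromℕ (a · b) ≡ fromℕ a * fromℕ b
fromℕ-* a b = ℚ.toℚᵘ-injective (begin
  ℚ.toℚᵘ (fromℕ (a · b))                    ≈⟨ toℚᵘ-/ (ℤ.+ (a · b)) 0 ⟩
  mkℚᵘ (ℤ.+ (a · b)) 0                        ≈⟨ *≡* (cong (ℤ._* (ℤ.+ 1)) (ℤ.pos-* a b)) ⟩
  mkℚᵘ (ℤ.+ a) 0 ℚᵘ.* mkℚᵘ (ℤ.+ b) 0            ≈⟨ ℚᵘ.*-cong (toℚᵘ-/ (ℤ.+ a) 0) (toℚᵘ-/ (ℤ.+ b) 0) ⟨
  ℚ.toℚᵘ (fromℕ a) ℚᵘ.* ℚ.toℚᵘ (fromℕ b)    ≈⟨ ℚ.toℚᵘ-homo-* (fromℕ a) (fromℕ b) ⟨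
  ℚ.toℚᵘ (fromℕ a * fromℕ b)                ∎)
  where open import Relation.Binary.Reasoning.Setoid ℚᵘ.≃-setoid

fromℕ-/ : ∀ a d .{{_ : NonZero d}} → fromℕ d * (ℤ.+ a / d) ≡ fromℕ a
fromℕ-/ a d@(suc d-1) = ℚ.toℚᵘ-injective (begin
  ℚ.toℚᵘ (fromℕ d * (ℤ.+ a / d))               ≈⟨ ℚ.toℚᵘ-homo-* (fromℕ d) (ℤ.+ a / d) ⟩
  ℚ.toℚᵘ (fromℕ d) ℚᵘ.* ℚ.toℚᵘ (ℤ.+ a / d)     ≈⟨ ℚᵘ.*-cong (toℚᵘ-/ (ℤ.+ d) 0) (toℚᵘ-/ (ℤ.+ a) d-1) ⟩
  mkℚᵘ (ℤ.+ d) 0 ℚᵘ.* mkℚᵘ (ℤ.+ a) d-1           ≈⟨ *≡* cross ⟩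
  mkℚᵘ (ℤ.+ a) 0                               ≈⟨ toℚᵘ-/ (ℤ.+ a) 0 ⟨
  ℚ.toℚᵘ (fromℕ a)                           ∎)
  where
  open import Relation.Binary.Reasoning.Setoid ℚᵘ.≃-setoid
  -- The product has denominator 1 times `d`, which computes to `d + 0`.
  cross : (ℤ.+ d ℤ.* ℤ.+ a) ℤ.* ℤ.+ 1 ≡ ℤ.+ a ℤ.* ℤ.+ (d + 0)
  cross = trans (ℤ.*-identityʳ _) (trans (ℤ.*-comm (ℤ.+ d) (ℤ.+ a)) (cong (λ z → ℤ.+ a ℤ.* ℤ.+ z) (sym (ℕ.+-identityʳ d))))

-- Equality is split into two inequalities, from each of which the positive factor is cancelled.
fromℕ-cancelˡ : ∀ d .{{_ : NonZero d}} {p q} → fromℕ d * p ≡ fromℕ d * q → p ≡ q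
fromℕ-cancelˡ d eq = ℚ.≤-antisym
  (ℚ.*-cancelˡ-≤-pos (fromℕ d) (ℚ.≤-reflexive eq))
  (ℚ.*-cancelˡ-≤-pos (fromℕ d) (ℚ.≤-reflexive (sym eq)))
  where instance
    d>0 : ℚ.Positive (fromℕ d)
    d>0 = ℚ.normalize-pos d 1

ℚ-ring : AlmostCommutativeRing 0ℓ 0ℓ
ℚ-ring = fromCommutativeRing ℚ.+-*-commutativeRing (λ p → dec⇒maybe (0ℚ ℚ.≟ p))

fromℕ-harmonic! : ∀ n → fromℕ (harmonic! n) ≡ fromℕ (n !) * H n
fromℕ-harmonic! zero    = refl
fromℕ-harmonic! (suc n) = begin
  fromℕ (suc n · harmonic! n + n !)
    ≡⟨ fromℕ-+ (suc n · harmonic! n) (n !) ⟩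
  fromℕ (suc n · harmonic! n) ℚ.+ fromℕ (n !)
    -- The summand n! is expanded to n! ((n + 1) (1 / (n + 1))), so that both summands share the
    -- factor (n + 1) n!.
    ≡⟨ cong₂ ℚ._+_ (trans (fromℕ-* (suc n) (harmonic! n)) (cong (fromℕ (suc n) *_) (fromℕ-harmonic! n)))
                   (trans (sym (ℚ.*-identityʳ (fromℕ (n !)))) (cong (fromℕ (n !) *_) (sym (fromℕ-/ 1 (suc n))))) ⟩
  fromℕ (suc n) * (fromℕ (n !) * H n) ℚ.+ fromℕ (n !) * (fromℕ (suc n) * (ℤ.+ 1 / suc n))
    ≡⟨ factor (fromℕ (suc n)) (fromℕ (n !)) (H n) (ℤ.+ 1 / suc n) ⟩
  fromℕ (suc n) * fromℕ (n !) * (H n ℚ.+ ℤ.+ 1 / suc n)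
    ≡⟨ cong (_* H (suc n)) (fromℕ-* (suc n) (n !)) ⟨
  fromℕ (suc n !) * H (suc n) ∎
  where
  open ≡-Reasoning
  factor : ∀ a b x y → a * (b * x) ℚ.+ b * (a * y) ≡ a * b * (x ℚ.+ y)
  factor = ring-∀ ℚ-ring

-- Carries the subtraction-free equation over to the rationals, where 4 n n! can be subtracted; it
-- serves for both `L n` and `A pivotAt n`.
fromℕ-closed : ∀ n X → X + 4 · n · n ! ≡ 2 · suc n · harmonic! n →
  fromℕ X ≡ fromℕ (n !) * (fromℕ 2 * fromℕ (suc n) * H n - fromℕ 4 * fromℕ n)
fromℕ-closed n X eq = begin
  fromℕ X
    ≡⟨ addSub (fromℕ X) (fromℕ 4 * fromℕ n * fromℕ (n !)) ⟩
  fromℕ X ℚ.+ fromℕ 4 * fromℕ n * fromℕ (n !) - fromℕ 4 * fromℕ n * fromℕ (n !)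
    ≡⟨ cong (_- fromℕ 4 * fromℕ n * fromℕ (n !)) eq′ ⟩
  fromℕ 2 * fromℕ (suc n) * (fromℕ (n !) * H n) - fromℕ 4 * fromℕ n * fromℕ (n !)
    ≡⟨ factor (fromℕ 2 * fromℕ (suc n)) (fromℕ (n !)) (H n) (fromℕ 4 * fromℕ n) ⟩
  fromℕ (n !) * (fromℕ 2 * fromℕ (suc n) * H n - fromℕ 4 * fromℕ n) ∎
  where
  open ≡-Reasoning
  addSub : ∀ x y → x ≡ x ℚ.+ y - y
  addSub = ring-∀ ℚ-ring
  factor : ∀ a f x b → a * (f * x) - b * f ≡ f * (a * x - b)
  factor = ring-∀ ℚ-ring
  fromℕ-*₃ : ∀ a b c → fromℕ (a · b · c) ≡ fromℕ a * fromℕ b * fromℕ c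
  fromℕ-*₃ a b c = trans (fromℕ-* (a · b) c) (cong (_* fromℕ c) (fromℕ-* a b))
  eq′ : fromℕ X ℚ.+ fromℕ 4 * fromℕ n * fromℕ (n !) ≡ fromℕ 2 * fromℕ (suc n) * (fromℕ (n !) * H n)
  eq′ = begin
    fromℕ X ℚ.+ fromℕ 4 * fromℕ n * fromℕ (n !)        ≡⟨ cong (fromℕ X ℚ.+_) (fromℕ-*₃ 4 n (n !)) ⟨
    fromℕ X ℚ.+ fromℕ (4 · n · n !)                    ≡⟨ fromℕ-+ X (4 · n · n !) ⟨
    fromℕ (X + 4 · n · n !)                            ≡⟨ cong fromℕ eq ⟩
    fromℕ (2 · suc n · harmonic! n)                    ≡⟨ fromℕ-*₃ 2 (suc n) (harmonic! n) ⟩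
    fromℕ 2 * fromℕ (suc n) * fromℕ (harmonic! n)      ≡⟨ cong (fromℕ 2 * fromℕ (suc n) *_) (fromℕ-harmonic! n) ⟩
    fromℕ 2 * fromℕ (suc n) * (fromℕ (n !) * H n)      ∎

A-closed : ∀ pivotAt n → A pivotAt n + 4 · n · n ! ≡ 2 · suc n · harmonic! n
A-closed pivotAt n = trans (cong (_+ 4 · n · n !) (A-quicksortTotal pivotAt n)) (quicksortTotal-closed n)

fromℕ-A : ∀ pivotAt n → fromℕ (A pivotAt n) ≡ fromℕ (n !) * Q pivotAt n
fromℕ-A pivotAt n = sym (fromℕ-/ (A pivotAt n) (n !) {{n ℕ.!≢0}})

theorem1 : (pivotAt : PivotRule) (n : ℕ) → n ≥ 2 →
    (L n ≡ A pivotAt n)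
    × (fromℕ (A pivotAt n) ≡ fromℕ (n !) * Q pivotAt n)
    × (Q pivotAt n ≡ fromℕ 2 * fromℕ (suc n) * H n - fromℕ 4 * fromℕ n)
    × (fromℕ (L n) ≡ fromℕ (n !) * (fromℕ 2 * fromℕ (suc n) * H n - fromℕ 4 * fromℕ n))
theorem1 pivotAt n@(suc m) _ =
    -- Both numbers become the same value after adding 4 n n!.
    ℕ.+-cancelʳ-≡ (4 · n · n !) _ _ (trans (L-closed m) (sym (A-closed pivotAt n)))
  , fromℕ-A pivotAt n
  , fromℕ-cancelˡ (n !) {{n ℕ.!≢0}} (trans (sym (fromℕ-A pivotAt n)) (fromℕ-closed n (A pivotAt n) (A-closed pivotAt n)))
  , fromℕ-closed n (L n) (L-closed m)
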